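{- There is a polynomial-time algorithm for Interval Scheduling with Colors.
   Context: Interval Scheduling with Colors: the input is a finite set of jobs with weights $w\ge0$, where each job $j$ has two half-open intervals $[\ell_j,r_j)$ and $[a_j,b_j)$ with $\ell_j\le a_j<b_j\le r_j$; the inner interval $[a_j,b_j)$ is called red and $[\ell_j,r_j)\setminus[a_j,b_j)$ blue. A set $S$ of jobs is feasible if for any two distinct jobs $j,k\in S$, $[a_j,b_j)\cap[\ell_k,r_k)=\emptyset$ and $[a_k,b_k)\cap[\ell_j,r_j)=\emptyset$ (the red interval of a chosen job meets neither the red nor the blue interval of another chosen job). The task is to find a feasible set of maximum total weight. -}

module Defs where

open import Data.Bool.Base using (Bool; true; false; if_then_else_)
open import Data.Fin.Base using (Fin)
open import Data.Fin.Subset using (Subset; _∈_)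
open import Data.Integer.Base as ℤ using (ℤ; 0ℤ; 1ℤ; ∣_∣)
open import Data.Nat.Base as ℕ using (ℕ; suc; _+_; _*_; _^_)
open import Data.Nat.Logarithm using (⌈log₂_⌉)
open import Data.Product.Base using (Σ; ∃-syntax; _×_; _,_)
open import Data.Rational.Base as ℚ using (ℚ; 0ℚ; ↥_; ↧_)
open import Data.Vec.Base using (Vec; []; _∷_; lookup)
open import Level using (0ℓ)
open import Relation.Binary.PropositionalEquality using (_≡_; _≢_)
open import Relation.Unary using (Pred; _∩_; Empty)

-- Model of computation: a variable-free WHILE language over binary trees
-- with integer leaves, under the logarithmic (bit-size) cost criterion.

data Data : Set where
  atom : ℤ → Data
  _∙_  : Data → Data → Data

infixr 5 _∙_

-- ⌈log₂ (1 + m)⌉ is the number of binary digits of m; the extra 1 on a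
-- leaf pays for the sign.
size : Data → ℕ
size (atom z) = suc ⌈log₂ suc ∣ z ∣ ⌉
size (x ∙ y)  = suc (size x + size y)

fromBool : Bool → Data
fromBool b = atom (if b then 1ℤ else 0ℤ)

truth : Data → Bool
truth (atom (ℤ.+ 0)) = false
truth _              = true

data Prim : Set where
  ident fst snd pair? add sub mul leq : Prim
  const : ℤ → Prim

arith : (ℤ → ℤ → Data) → Data → Data
arith _⊕_ (atom m ∙ atom n) = m ⊕ n
arith _⊕_ _                 = atom 0ℤ

-- Ill-formed arguments yield the leaf 0, so only loops can diverge.
⟦_⟧ : Prim → Data → Data
⟦ ident ⟧   x        = x
⟦ fst ⟧     (x ∙ _)  = x
⟦ fst ⟧     (atom _) = atom 0ℤ
⟦ snd ⟧     (_ ∙ y)  = y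
⟦ snd ⟧     (atom _) = atom 0ℤ
⟦ pair? ⟧   (_ ∙ _)  = fromBool true
⟦ pair? ⟧   (atom _) = fromBool false
⟦ add ⟧     x        = arith (λ m n → atom (m ℤ.+ n)) x
⟦ sub ⟧     x        = arith (λ m n → atom (m ℤ.- n)) x
⟦ mul ⟧     x        = arith (λ m n → atom (m ℤ.* n)) x
⟦ leq ⟧     x        = arith (λ m n → fromBool (m ℤ.≤ᵇ n)) x
⟦ const z ⟧ _        = atom z

infixr 4 _⨾_

data Prog : Set where
  prim  : Prim → Prog
  _⨾_   : Prog → Prog → Prog
  ⟨_,_⟩ : Prog → Prog → Prog
  cond  : Prog → Prog → Prog → Prog
  while : Prog → Prog → Prog

-- p ⊢ x ⇓ y [ t ] : on input x the program p halts with output y at cost t.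
-- Every step is charged at least the bit size of the data it reads, copies
-- or writes, so t bounds the size of every intermediate value.  As each
-- primitive is computable by a Turing machine in time polynomial in its
-- charge, polynomial cost here is polynomial time on a Turing machine, and
-- conversely.
infix 3 _⊢_⇓_[_]

data _⊢_⇓_[_] : Prog → Data → Data → ℕ → Set where

  run-prim : ∀ {o x} →
             prim o ⊢ x ⇓ ⟦ o ⟧ x [ suc (size x + size (⟦ o ⟧ x)) ]

  run-⨾ : ∀ {p q x y z s t} →
          p ⊢ x ⇓ y [ s ] → q ⊢ y ⇓ z [ t ] →
          p ⨾ q ⊢ x ⇓ z [ suc (s + t) ]

  run-pair : ∀ {p q x y z s t} →
             p ⊢ x ⇓ y [ s ] → q ⊢ x ⇓ z [ t ] →
             ⟨ p , q ⟩ ⊢ x ⇓ y ∙ z [ suc (size x + (s + t)) ]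

  run-then : ∀ {c p q x b y s t} →
             c ⊢ x ⇓ b [ s ] → truth b ≡ true → p ⊢ x ⇓ y [ t ] →
             cond c p q ⊢ x ⇓ y [ suc (size x + (s + t)) ]

  run-else : ∀ {c p q x b y s t} →
             c ⊢ x ⇓ b [ s ] → truth b ≡ false → q ⊢ x ⇓ y [ t ] →
             cond c p q ⊢ x ⇓ y [ suc (size x + (s + t)) ]

  run-stop : ∀ {c p x b s} →
             c ⊢ x ⇓ b [ s ] → truth b ≡ false →
             while c p ⊢ x ⇓ x [ suc (size x + s) ]

  run-loop : ∀ {c p x b y z s t u} →
             c ⊢ x ⇓ b [ s ] → truth b ≡ true →
             p ⊢ x ⇓ y [ t ] → while c p ⊢ y ⇓ z [ u ] →
             while c p ⊢ x ⇓ z [ suc (size x + (s + (t + u))) ]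

record SearchProblem : Set₁ where
  field
    Instance       : Set
    Answer         : Instance → Set
    Correct        : (I : Instance) → Answer I → Set
    encodeInstance : Instance → Data
    encodeAnswer   : {I : Instance} → Answer I → Data

-- One fixed program answers every instance correctly, in time
-- O(N ^ d), where N is the bit size of the encoded instance.
PolynomialTimeSolvable : SearchProblem → Set
PolynomialTimeSolvable Π =
  Σ Prog λ p → ∃[ c ] ∃[ d ] ((I : Instance) →
    Σ (Answer I) λ A → ∃[ t ]
      (p ⊢ encodeInstance I ⇓ encodeAnswer A [ t ])
      × t ℕ.≤ c * size (encodeInstance I) ^ d
      × Correct I A)
  where open SearchProblem Π

encodeVec : ∀ {A : Set} {n} → (A → Data) → Vec A n → Data
encodeVec f []       = atom 0ℤ
encodeVec f (x ∷ xs) = f x ∙ encodeVec f xs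

encodeℚ : ℚ → Data
encodeℚ q = atom (↥ q) ∙ atom (↧ q)

[_,_⟩ : ℚ → ℚ → Pred ℚ 0ℓ
[ u , v ⟩ x = u ℚ.≤ x × x ℚ.< v

record Job : Set where
  field
    ℓ r a b w : ℚ
    ℓ≤a       : ℓ ℚ.≤ a
    a<b       : a ℚ.< b
    b≤r       : b ℚ.≤ r
    w≥0       : 0ℚ ℚ.≤ w

  -- The red interval, and the union of the red and the blue part.
  red whole : Pred ℚ 0ℓ
  red   = [ a , b ⟩
  whole = [ ℓ , r ⟩

open Job using (red; whole)

Feasible : ∀ {n} → Vec Job n → Subset n → Set
Feasible {n} js S =
  (j k : Fin n) → j ∈ S → k ∈ S → j ≢ k →
    Empty (red (lookup js j) ∩ whole (lookup js k))
  × Empty (red (lookup js k) ∩ whole (lookup js j))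

totalWeight : ∀ {n} → Vec Job n → Subset n → ℚ
totalWeight []       []          = 0ℚ
totalWeight (j ∷ js) (true  ∷ S) = Job.w j ℚ.+ totalWeight js S
totalWeight (j ∷ js) (false ∷ S) = totalWeight js S

MaximumWeightFeasible : ∀ {n} → Vec Job n → Subset n → Set
MaximumWeightFeasible {n} js S =
  Feasible js S ×
  ((T : Subset n) → Feasible js T → totalWeight js T ℚ.≤ totalWeight js S)

encodeJob : Job → Data
encodeJob j =
  encodeℚ ℓ ∙ encodeℚ r ∙ encodeℚ a ∙ encodeℚ b ∙ encodeℚ w
  where open Job j

-- Jobs are identified by their position, so distinct jobs may carry the
-- same intervals and weight.
IntervalSchedulingWithColors : SearchProblem
IntervalSchedulingWithColors = record
  { Instance       = Σ ℕ (Vec Job)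
  ; Answer         = λ (n , _) → Subset n
  ; Correct        = λ (_ , js) S → MaximumWeightFeasible js S
  ; encodeInstance = λ (_ , js) → encodeVec encodeJob js
  ; encodeAnswer   = encodeVec fromBool
  }

{-# OPTIONS --safe #-}
-- Write j ≺ k if b_j ≤ ℓ_k and r_j ≤ a_k.  This is a strict partial order, and
-- because red intervals are nonempty, two jobs can be chosen together exactly
-- if they are comparable.  So the task is to find a heaviest chain.  Start from
-- the empty chain alone, and in each round put every job k on top of a heaviest
-- kept chain lying below k, keeping the empty chain as well.  After t rounds
-- every feasible set of at most t jobs is matched in weight by a kept chain that
-- lies below every job above the set; hence n rounds suffice, without sorting.
--
-- Weights are summed as unnormalised fractions: their bit lengths add up along
-- a chain, so all numbers stay of polynomial size.

module Submission where

open import Defs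
open import Data.Bool.Base using (Bool; true; false; T; if_then_else_; _∧_; _∨_)
open import Data.Bool.Properties using (T-≡; T-∧; T-∨; if-float)
open import Data.Empty using (⊥-elim)
open import Data.Fin.Base using (Fin; zero; suc; toℕ)
open import Data.Fin.Properties using (toℕ-injective)
open import Data.Fin.Subset using (Subset; outside; _∈_; Nonempty) renaming (∣_∣ to card)
open import Data.Fin.Subset.Properties using (nonempty?; ∣p∣≤n)
open import Data.Integer.Base as ℤ using (ℤ; 0ℤ; 1ℤ; ∣_∣)
import Data.Integer.Properties as ℤ
open import Data.List.Base as List using (List; []; _∷_; _++_; allFin; foldl; foldr; length; map; reverse)
open import Data.List.Membership.Propositional using () renaming (_∈_ to _∈ₗ_)
open import Data.List.Membership.Propositional.Properties using (∈-allFin)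
open import Data.List.Properties using (foldl-map; length-reverse; length-tabulate; map-tabulate; reverse-foldl; reverse-foldr)
open import Data.List.Relation.Unary.All as All using (All; []; _∷_)
open import Data.List.Relation.Unary.AllPairs using (AllPairs; []; _∷_)
open import Data.List.Relation.Unary.Any as Any using (Any; here; there)
open import Data.List.Relation.Unary.Any.Properties using (reverse⁺)
open import Data.Nat.Base
open import Data.Nat.Induction using (<-wellFounded)
open import Data.Nat.Logarithm using (⌈log₂_⌉; ⌈log₂⌉-mono-≤; ⌈log₂2^n⌉≡n)
open import Data.Nat.Logarithm.Core using (⌈log2⌉)
open import Data.Nat.Properties
open import Data.Nat.Tactic.RingSolver using (solve-∀)
open import Data.Product.Base using (Σ; ∃-syntax; _×_; _,_; proj₁; proj₂)
open import Data.Rational.Base as ℚ using (ℚ; 0ℚ; toℚᵘ)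
import Data.Rational.Properties as ℚ
open import Data.Rational.Unnormalised.Base as ℚᵘ using (ℚᵘ; 0ℚᵘ; mkℚᵘ; _≃_; ↥_; ↧_; ↧ₙ_)
import Data.Rational.Unnormalised.Properties as ℚᵘ
open import Data.Sum.Base using (_⊎_; inj₁; inj₂; [_,_]′)
open import Data.Unit.Base using (⊤; tt)
open import Data.Vec.Base as Vec using (Vec; []; _∷_; here; there; lookup; tabulate; toList; _[_]≔_)
open import Data.Vec.Properties using (lookup∘update; lookup∘update′; lookup∘tabulate; lookup⇒[]=; []=⇒lookup)
open import Function.Base using (_∘_; id; flip)
open import Function.Bundles using (module Equivalence)
open import Induction.WellFounded using (Acc; acc)
open import Relation.Binary.PropositionalEquality
open import Relation.Nullary using (¬_; Dec; yes; no; contradiction)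
open import Relation.Unary using (Empty; _∩_)

open Equivalence using (to; from)
open Job using (red; whole)

-- Polynomials

-- A kept chain may stand in for a feasible set only if it can still be continued by every job that
-- continues the set; equal weight alone would not survive the next round. On the machine, the
-- obstacle is iteration. A polynomial-time step repeated n times need not take polynomial time,
-- because the data may grow at each turn. Every loop therefore needs a bound on all its
-- intermediate states that does not come from iterating the bound for one step. For the table it
-- comes from the shape: at most n + 1 chains, none with more jobs than there were rounds.
-- Unnormalised fractions also spare the machine a gcd.

infixl 6 _⊕_
infixl 7 _⊗_
infixr 8 _⊚_

-- Bounds are kept as syntax so that a degree and a coefficient can be read off at the end. `_⊚_`
-- arises from sequencing: the cost of the second program is a polynomial in the size of the first
-- one's output.
data Poly : Set where
  con         : ℕ → Poly
  var         : Poly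
  _⊕_ _⊗_ _⊚_ : Poly → Poly → Poly

eval : Poly → ℕ → ℕ
eval (con k) n = k
eval var     n = n
eval (p ⊕ q) n = eval p n + eval q n
eval (p ⊗ q) n = eval p n * eval q n
eval (p ⊚ q) n = eval p (eval q n)

eval-mono : ∀ p {m n} → m ≤ n → eval p m ≤ eval p n
eval-mono (con k) m≤n = ≤-refl
eval-mono var     m≤n = m≤n
eval-mono (p ⊕ q) m≤n = +-mono-≤ (eval-mono p m≤n) (eval-mono q m≤n)
eval-mono (p ⊗ q) m≤n = *-mono-≤ (eval-mono p m≤n) (eval-mono q m≤n)
eval-mono (p ⊚ q) m≤n = eval-mono p (eval-mono q m≤n)

-- Parameters of a bound c (1 + n)^d. The base is at least 1, so exponents may be raised freely, and
-- adding the degrees of a sum is good enough in place of their maximum. The `suc` under composition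
-- absorbs the 1 in `suc (eval q n)`.
coeff degree : Poly → ℕ
coeff (con k) = k
coeff var     = 1
coeff (p ⊕ q) = coeff p + coeff q
coeff (p ⊗ q) = coeff p * coeff q
coeff (p ⊚ q) = coeff p * suc (coeff q) ^ degree p
degree (con k) = 0
degree var     = 1
degree (p ⊕ q) = degree p + degree q
degree (p ⊗ q) = degree p + degree q
degree (p ⊚ q) = degree q * degree p

^-distribʳ-* : ∀ k m n → (m * n) ^ k ≡ m ^ k * n ^ k
^-distribʳ-* zero    m n = refl
^-distribʳ-* (suc k) m n = begin
  m * n * (m * n) ^ k       ≡⟨ cong (m * n *_) (^-distribʳ-* k m n) ⟩
  m * n * (m ^ k * n ^ k)   ≡⟨ [m*n]*[o*p]≡[m*o]*[n*p] m n (m ^ k) (n ^ k) ⟩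
  m * m ^ k * (n * n ^ k)   ∎
  where open ≡-Reasoning

eval≤ : ∀ p n → eval p n ≤ coeff p * suc n ^ degree p
eval≤ (con k) n = ≤-reflexive (sym (*-identityʳ k))
eval≤ var     n = begin
  n                   ≤⟨ n≤1+n n ⟩
  suc n               ≡⟨ *-identityʳ (suc n) ⟨
  suc n ^ 1           ≡⟨ *-identityˡ _ ⟨
  1 * suc n ^ 1       ∎
  where open ≤-Reasoning
eval≤ (p ⊕ q) n = begin
  eval p n + eval q n
    ≤⟨ +-mono-≤ (eval≤ p n) (eval≤ q n) ⟩
  coeff p * suc n ^ degree p + coeff q * suc n ^ degree q
    ≤⟨ +-mono-≤ (*-monoʳ-≤ (coeff p) (^-monoʳ-≤ (suc n) (m≤m+n (degree p) (degree q))))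
                (*-monoʳ-≤ (coeff q) (^-monoʳ-≤ (suc n) (m≤n+m (degree q) (degree p)))) ⟩
  coeff p * suc n ^ (degree p + degree q) + coeff q * suc n ^ (degree p + degree q)
    ≡⟨ *-distribʳ-+ (suc n ^ (degree p + degree q)) (coeff p) (coeff q) ⟨
  (coeff p + coeff q) * suc n ^ (degree p + degree q) ∎
  where open ≤-Reasoning
eval≤ (p ⊗ q) n = begin
  eval p n * eval q n
    ≤⟨ *-mono-≤ (eval≤ p n) (eval≤ q n) ⟩
  coeff p * suc n ^ degree p * (coeff q * suc n ^ degree q)
    ≡⟨ [m*n]*[o*p]≡[m*o]*[n*p] (coeff p) (suc n ^ degree p) (coeff q) (suc n ^ degree q) ⟩
  coeff p * coeff q * (suc n ^ degree p * suc n ^ degree q)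
    ≡⟨ cong (coeff p * coeff q *_) (^-distribˡ-+-* (suc n) (degree p) (degree q)) ⟨
  coeff p * coeff q * suc n ^ (degree p + degree q) ∎
  where open ≤-Reasoning
eval≤ (p ⊚ q) n = begin
  eval p (eval q n)
    ≤⟨ eval≤ p (eval q n) ⟩
  coeff p * suc (eval q n) ^ degree p
    ≤⟨ *-monoʳ-≤ (coeff p) (^-monoˡ-≤ (degree p)
         (+-mono-≤ (m^n>0 (suc n) (degree q)) (eval≤ q n))) ⟩
  coeff p * (suc (coeff q) * suc n ^ degree q) ^ degree p
    ≡⟨ cong (coeff p *_) (^-distribʳ-* (degree p) (suc (coeff q)) (suc n ^ degree q)) ⟩
  coeff p * (suc (coeff q) ^ degree p * (suc n ^ degree q) ^ degree p)
    ≡⟨ *-assoc (coeff p) _ _ ⟨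
  coeff p * suc (coeff q) ^ degree p * (suc n ^ degree q) ^ degree p
    ≡⟨ cong (coeff p * suc (coeff q) ^ degree p *_) (^-*-assoc (suc n) (degree q) (degree p)) ⟩
  coeff p * suc (coeff q) ^ degree p * suc n ^ (degree q * degree p) ∎
  where open ≤-Reasoning

eval≤monomial : ∀ p n → 1 ≤ n → eval p n ≤ coeff p * 2 ^ degree p * n ^ degree p
eval≤monomial p n 1≤n = begin
  eval p n                                   ≤⟨ eval≤ p n ⟩
  coeff p * suc n ^ degree p                 ≤⟨ *-monoʳ-≤ (coeff p) (^-monoˡ-≤ (degree p) 1+n≤2n) ⟩
  coeff p * (2 * n) ^ degree p               ≡⟨ cong (coeff p *_) (^-distribʳ-* (degree p) 2 n) ⟩
  coeff p * (2 ^ degree p * n ^ degree p)    ≡⟨ *-assoc (coeff p) _ _ ⟨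
  coeff p * 2 ^ degree p * n ^ degree p      ∎
  where
  open ≤-Reasoning
  1+n≤2n : suc n ≤ 2 * n
  1+n≤2n = +-mono-≤ 1≤n (≤-reflexive (sym (+-identityʳ n)))

-- Size and cost

1≤size : ∀ x → 1 ≤ size x
1≤size (atom z) = s≤s z≤n
1≤size (x ∙ y)  = s≤s z≤n

size-left : ∀ x y → size x ≤ size (x ∙ y)
size-left x y = ≤-trans (m≤m+n (size x) (size y)) (n≤1+n _)

size-right : ∀ x y → size y ≤ size (x ∙ y)
size-right x y = ≤-trans (m≤n+m (size y) (size x)) (n≤1+n _)

-- Stated for an arbitrary accessibility proof, since `⌈log2⌉` recurses on it. Each halving adds one
-- to the exponent, and twice the rounded-up half is at least the number.
n≤2^⌈log2⌉ : ∀ n (rec : Acc _<_ n) → n ≤ 2 ^ ⌈log2⌉ n rec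
n≤2^⌈log2⌉ 0 _ = z≤n
n≤2^⌈log2⌉ 1 _ = ≤-refl
n≤2^⌈log2⌉ (suc (suc n)) (acc rs) = begin
  suc (suc n)                            ≡⟨ ⌊n/2⌋+⌈n/2⌉≡n (suc (suc n)) ⟨
  ⌊ suc (suc n) /2⌋ + ⌈ suc (suc n) /2⌉  ≤⟨ +-monoˡ-≤ _ (⌊n/2⌋≤⌈n/2⌉ (suc (suc n))) ⟩
  ⌈ suc (suc n) /2⌉ + ⌈ suc (suc n) /2⌉  ≤⟨ +-mono-≤ ih (≤-trans ih (m≤m+n _ 0)) ⟩
  2 ^ ⌈log2⌉ (suc (suc n)) (acc rs)      ∎
  where
  open ≤-Reasoning
  ih = n≤2^⌈log2⌉ (suc ⌈ n /2⌉) (rs (⌈n/2⌉<n n))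

⌈log₂⌉-*-≤ : ∀ m n → ⌈log₂ (m * n) ⌉ ≤ ⌈log₂ m ⌉ + ⌈log₂ n ⌉
⌈log₂⌉-*-≤ m n = begin
  ⌈log₂ (m * n) ⌉
    ≤⟨ ⌈log₂⌉-mono-≤ (*-mono-≤ (n≤2^⌈log2⌉ m (<-wellFounded m)) (n≤2^⌈log2⌉ n (<-wellFounded n))) ⟩
  ⌈log₂ (2 ^ ⌈log₂ m ⌉ * 2 ^ ⌈log₂ n ⌉) ⌉
    ≡⟨ cong ⌈log₂_⌉ (^-distribˡ-+-* 2 ⌈log₂ m ⌉ ⌈log₂ n ⌉) ⟨
  ⌈log₂ (2 ^ (⌈log₂ m ⌉ + ⌈log₂ n ⌉)) ⌉
    ≡⟨ ⌈log₂2^n⌉≡n (⌈log₂ m ⌉ + ⌈log₂ n ⌉) ⟩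
  ⌈log₂ m ⌉ + ⌈log₂ n ⌉ ∎
  where open ≤-Reasoning

-- `⌈log₂_⌉` is subadditive on products, so one criterion covers both operations: 1 + |m + n| and 1
-- + |mn| are each at most (1 + |m|)(1 + |n|).
size-atom-≤ : ∀ {k m n} → suc ∣ k ∣ ≤ suc ∣ m ∣ * suc ∣ n ∣ → size (atom k) ≤ size (atom m ∙ atom n)
size-atom-≤ {k} {m} {n} k≤mn = s≤s (begin
  ⌈log₂ suc ∣ k ∣ ⌉                          ≤⟨ ⌈log₂⌉-mono-≤ k≤mn ⟩
  ⌈log₂ (suc ∣ m ∣ * suc ∣ n ∣) ⌉            ≤⟨ ⌈log₂⌉-*-≤ (suc ∣ m ∣) (suc ∣ n ∣) ⟩
  ⌈log₂ suc ∣ m ∣ ⌉ + ⌈log₂ suc ∣ n ∣ ⌉      ≤⟨ +-mono-≤ (n≤1+n _) (n≤1+n _) ⟩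
  size (atom m) + size (atom n)              ∎)
  where open ≤-Reasoning

size-+ : ∀ m n → size (atom (m ℤ.+ n)) ≤ size (atom m ∙ atom n)
size-+ m n = size-atom-≤ {m ℤ.+ n} {m} {n} (s≤s (begin
  ∣ m ℤ.+ n ∣                      ≤⟨ ℤ.∣i+j∣≤∣i∣+∣j∣ m n ⟩
  ∣ m ∣ + ∣ n ∣                    ≡⟨ +-comm ∣ m ∣ ∣ n ∣ ⟩
  ∣ n ∣ + ∣ m ∣                    ≤⟨ +-monoʳ-≤ ∣ n ∣ (m≤m*n ∣ m ∣ (suc ∣ n ∣)) ⟩
  ∣ n ∣ + ∣ m ∣ * suc ∣ n ∣        ∎))
  where open ≤-Reasoning

size-* : ∀ m n → size (atom (m ℤ.* n)) ≤ size (atom m ∙ atom n)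
size-* m n = size-atom-≤ {m ℤ.* n} {m} {n} (s≤s (begin
  ∣ m ℤ.* n ∣                      ≡⟨ ℤ.abs-* m n ⟩
  ∣ m ∣ * ∣ n ∣                    ≤⟨ *-monoʳ-≤ ∣ m ∣ (n≤1+n ∣ n ∣) ⟩
  ∣ m ∣ * suc ∣ n ∣                ≤⟨ m≤n+m _ ∣ n ∣ ⟩
  ∣ n ∣ + ∣ m ∣ * suc ∣ n ∣        ∎))
  where open ≤-Reasoning

size-fromBool : ∀ b → size (fromBool b) ≤ 2
size-fromBool true  = ≤-refl
size-fromBool false = s≤s z≤n

-- Every rule charges for its output or inherits the charge from the sub-runs that produced it. In a
-- sequence this turns the cost bound of the first program into a bound on the input of the second.
size-output : ∀ {p x y t} → p ⊢ x ⇓ y [ t ] → size y ≤ t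
size-output (run-prim {x = x})   = ≤-trans (m≤n+m _ (size x)) (n≤1+n _)
size-output (run-⨾ {s = s} _ q)  = ≤-trans (size-output q) (≤-trans (m≤n+m _ s) (n≤1+n _))
size-output (run-pair {x = x} p q) =
  s≤s (≤-trans (+-mono-≤ (size-output p) (size-output q)) (m≤n+m _ (size x)))
size-output (run-then {x = x} {s = s} _ _ p) =
  ≤-trans (size-output p) (≤-trans (m≤n+m _ s) (≤-trans (m≤n+m _ (size x)) (n≤1+n _)))
size-output (run-else {x = x} {s = s} _ _ p) =
  ≤-trans (size-output p) (≤-trans (m≤n+m _ s) (≤-trans (m≤n+m _ (size x)) (n≤1+n _)))
size-output (run-stop {x = x} _ _) = ≤-trans (m≤m+n (size x) _) (n≤1+n _)
size-output (run-loop {x = x} {s = s} {t = t} _ _ _ p) =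
  ≤-trans (size-output p) (≤-trans (m≤n+m _ t) (≤-trans (m≤n+m _ s)
    (≤-trans (m≤n+m _ (size x)) (n≤1+n _))))

-- Functions computed in polynomial time

infix 2 _⟿_

-- One program takes f γ to g γ for every γ, in time polynomial in the size of
-- f γ.  The index type Γ carries whatever is known about well-formed inputs,
-- so no behaviour on other inputs has to be specified.
record _⟿_ {Γ : Set} (f g : Γ → Data) : Set where
  constructor computes
  field
    program : Prog
    bound   : Poly
    runs    : ∀ γ → ∃[ t ] (program ⊢ f γ ⇓ g γ [ t ]) × t ≤ eval bound (size (f γ))

open _⟿_

private variable
  Γ Δ   : Set
  f g h : Γ → Data

_at_ : f ⟿ g → (s : Δ → Γ) → (f ∘ s) ⟿ (g ∘ s)
(P at s) = computes (program P) (bound P) (runs P ∘ s)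

recast : (∀ γ → g γ ≡ h γ) → f ⟿ g → f ⟿ h
recast {f = f} g≗h P = computes (program P) (bound P) λ γ →
  let t , r , t≤ = runs P γ in t , subst (λ y → program P ⊢ f γ ⇓ y [ t ]) (g≗h γ) r , t≤

primop : ∀ o q → (∀ γ → g γ ≡ ⟦ o ⟧ (f γ)) → (∀ γ → size (g γ) ≤ eval q (size (f γ))) → f ⟿ g
primop {f = f} o q eq g≤q = recast (sym ∘ eq) (computes (prim o) (con 1 ⊕ (var ⊕ q)) λ γ →
  _ , run-prim , s≤s (+-monoʳ-≤ (size (f γ)) (subst (λ y → size y ≤ _) (eq γ) (g≤q γ))))

id⟿ : f ⟿ f
id⟿ = primop ident var (λ _ → refl) (λ _ → ≤-refl)

fst⟿ : (λ γ → f γ ∙ g γ) ⟿ f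
fst⟿ {f = f} {g} = primop fst var (λ _ → refl) (λ γ → size-left (f γ) (g γ))

snd⟿ : (λ γ → f γ ∙ g γ) ⟿ g
snd⟿ {f = f} {g} = primop snd var (λ _ → refl) (λ γ → size-right (f γ) (g γ))

infixl 3 _▹_

_▹_ : f ⟿ g → g ⟿ h → f ⟿ h
P ▹ Q = computes (program P ⨾ program Q) (con 1 ⊕ (bound P ⊕ bound Q ⊚ bound P)) λ γ →
  let s , p , s≤ = runs P γ
      t , q , t≤ = runs Q γ
  in  _ , run-⨾ p q ,
      s≤s (+-mono-≤ s≤ (≤-trans t≤ (eval-mono (bound Q) (≤-trans (size-output p) s≤))))

infixr 5 _∥_

_∥_ : f ⟿ g → f ⟿ h → f ⟿ (λ γ → g γ ∙ h γ)
_∥_ {f = f} P Q = computes ⟨ program P , program Q ⟩ (con 1 ⊕ (var ⊕ (bound P ⊕ bound Q))) λ γ →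
  let s , p , s≤ = runs P γ
      t , q , t≤ = runs Q γ
  in  _ , run-pair p q , s≤s (+-monoʳ-≤ (size (f γ)) (+-mono-≤ s≤ t≤))

π₁ : f ⟿ (λ γ → g γ ∙ h γ) → f ⟿ g
π₁ P = P ▹ fst⟿

π₂ : f ⟿ (λ γ → g γ ∙ h γ) → f ⟿ h
π₂ P = P ▹ snd⟿

const⟿ : ∀ z → f ⟿ (λ _ → atom z)
const⟿ z = primop (const z) (con (size (atom z))) (λ _ → refl) (λ _ → ≤-refl)

if⟿ : {b : Γ → Bool} {f g h : Γ → Data} →
      f ⟿ fromBool ∘ b → f ⟿ g → f ⟿ h → f ⟿ (λ γ → if b γ then g γ else h γ)
if⟿ {b = b} {f} {g} {h} P Q R =
  computes (cond (program P) (program Q) (program R))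
    (con 1 ⊕ (var ⊕ (bound P ⊕ (bound Q ⊕ bound R)))) run
  where
  run : ∀ γ → ∃[ t ] (_ ⊢ f γ ⇓ (if b γ then g γ else h γ) [ t ]) × t ≤ _
  run γ with b γ | runs P γ
  ... | true  | s , p , s≤ = let t , q , t≤ = runs Q γ in
    _ , run-then p refl q ,
    s≤s (+-monoʳ-≤ (size (f γ)) (+-mono-≤ s≤ (≤-trans t≤ (m≤m+n _ _))))
  ... | false | s , p , s≤ = let t , q , t≤ = runs R γ in
    _ , run-else p refl q ,
    s≤s (+-monoʳ-≤ (size (f γ)) (+-mono-≤ s≤ (≤-trans t≤ (m≤n+m _ _))))

∧⟿ : {b c : Γ → Bool} → f ⟿ fromBool ∘ b → f ⟿ fromBool ∘ c → f ⟿ (λ γ → fromBool (b γ ∧ c γ))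
∧⟿ {b = b} {c} P Q = recast eq (if⟿ P Q (const⟿ 0ℤ))
  where
  eq : ∀ γ → (if b γ then fromBool (c γ) else atom 0ℤ) ≡ fromBool (b γ ∧ c γ)
  eq γ with b γ
  ... | true  = refl
  ... | false = refl

∨⟿ : {b c : Γ → Bool} → f ⟿ fromBool ∘ b → f ⟿ fromBool ∘ c → f ⟿ (λ γ → fromBool (b γ ∨ c γ))
∨⟿ {b = b} {c} P Q = recast eq (if⟿ P (const⟿ 1ℤ) Q)
  where
  eq : ∀ γ → (if b γ then atom 1ℤ else fromBool (c γ)) ≡ fromBool (b γ ∨ c γ)
  eq γ with b γ
  ... | true  = refl
  ... | false = refl

+⟿ : {m n : Γ → ℤ} → f ⟿ atom ∘ m → f ⟿ atom ∘ n → f ⟿ (λ γ → atom (m γ ℤ.+ n γ))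
+⟿ {m = m} {n} P Q = P ∥ Q ▹ primop add var (λ _ → refl) (λ γ → size-+ (m γ) (n γ))

*⟿ : {m n : Γ → ℤ} → f ⟿ atom ∘ m → f ⟿ atom ∘ n → f ⟿ (λ γ → atom (m γ ℤ.* n γ))
*⟿ {m = m} {n} P Q = P ∥ Q ▹ primop mul var (λ _ → refl) (λ γ → size-* (m γ) (n γ))

≤ᵇ⟿ : {m n : Γ → ℤ} → f ⟿ atom ∘ m → f ⟿ atom ∘ n → f ⟿ (λ γ → fromBool (m γ ℤ.≤ᵇ n γ))
≤ᵇ⟿ {m = m} {n} P Q = P ∥ Q ▹ primop leq (con 2) (λ _ → refl) (λ γ → size-fromBool (m γ ℤ.≤ᵇ n γ))

-- Folding lists in polynomial time

encodeList : {A : Set} → (A → Data) → List A → Data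
encodeList e []       = atom 0ℤ
encodeList e (x ∷ xs) = e x ∙ encodeList e xs

module _ {A : Set} (e : A → Data) where

  length<size : ∀ xs → length xs < size (encodeList e xs)
  length<size []       = s≤s z≤n
  length<size (x ∷ xs) = s≤s (≤-trans (length<size xs) (m≤n+m _ (size (e x))))

  size-prefix : ∀ xs ys → size (encodeList e xs) ≤ size (encodeList e (xs ++ ys))
  size-prefix []       ys = 1≤size (encodeList e ys)
  size-prefix (x ∷ xs) ys = s≤s (+-monoʳ-≤ (size (e x)) (size-prefix xs ys))

-- `foldl` as a `while` loop on environment, accumulator and remaining list. A polynomial-time
-- `step` does not suffice, as the accumulator could grow exponentially in the number of turns;
-- `fold≤q` excludes this. Being stated for all lists, it applies to each prefix, hence to each
-- intermediate state.
module Fold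
  {Γ : Set} {X B : Γ → Set} {env : Γ → Data}
  {encodeX : ∀ γ → X γ → Data} {encodeB : ∀ γ → B γ → Data}
  (b₀ : ∀ γ → B γ) (step : ∀ γ → B γ → X γ → B γ)
  (init  : env ⟿ (λ γ → encodeB γ (b₀ γ)))
  (step⟿ : _⟿_ {Σ Γ λ γ → B γ × X γ}
             (λ (γ , b , x) → env γ ∙ encodeB γ b ∙ encodeX γ x)
             (λ (γ , b , x) → encodeB γ (step γ b x)))
  (q : Poly)
  (fold≤q : ∀ γ xs → size (encodeB γ (foldl (step γ) (b₀ γ) xs))
                       ≤ eval q (size (env γ ∙ encodeList (encodeX γ) xs)))
  where

  private
    state : ∀ γ → B γ → List (X γ) → Data
    state γ b xs = env γ ∙ encodeB γ b ∙ encodeList (encodeX γ) xs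

    body : _⟿_ {Σ Γ λ γ → B γ × X γ × List (X γ)}
      (λ (γ , b , x , xs) → state γ b (x ∷ xs)) (λ (γ , b , x , xs) → state γ (step γ b x) xs)
    body = fst⟿ ∥ ((fst⟿ ∥ π₁ snd⟿ ∥ π₁ (π₂ snd⟿)) ▹ (step⟿ at λ (γ , b , x , _) → γ , b , x))
                ∥ π₂ (π₂ snd⟿)

    nonempty : Σ Γ (λ γ → B γ × List (X γ)) → Bool
    nonempty (_ , _ , [])    = false
    nonempty (_ , _ , _ ∷ _) = true

    test : (λ (γ , b , xs) → state γ b xs) ⟿ fromBool ∘ nonempty
    test = π₂ snd⟿ ▹ primop pair? (con 2) (λ where (_ , _ , []) → refl ; (_ , _ , _ ∷ _) → refl)
                                             (λ γ → size-fromBool (nonempty γ))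

    loop : Prog
    loop = while (program test) (program body)

    turn : Poly
    turn = con 1 ⊕ (var ⊕ (bound test ⊕ bound body))

    -- `S` bounds every state still to come, each being given by a split of the remaining list, so a
    -- turn costs at most `eval turn S`. The `suc` counts the last test, which fails.
    loop-runs : ∀ γ S b xs →
      (∀ ys zs → ys ++ zs ≡ xs → size (state γ (foldl (step γ) b ys) zs) ≤ S) →
      ∃[ t ] (loop ⊢ state γ b xs ⇓ state γ (foldl (step γ) b xs) [] [ t ])
             × t ≤ suc (length xs) * eval turn S
    loop-runs γ S b [] small =
      let s , p , s≤ = runs test (γ , b , []) in
      _ , run-stop p refl , ≤-trans
        (s≤s (+-mono-≤ (small [] [] refl)
          (≤-trans s≤ (≤-trans (eval-mono (bound test) (small [] [] refl)) (m≤m+n _ _)))))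
        (m≤m+n _ 0)
    loop-runs γ S b (x ∷ xs) small =
      let s , p , s≤ = runs test (γ , b , x ∷ xs)
          t , r , t≤ = runs body (γ , b , x , xs)
          u , l , u≤ = loop-runs γ S (step γ b x) xs
                         (λ ys zs eq → small (x ∷ ys) zs (cong (x ∷_) eq))
          now        = small [] (x ∷ xs) refl
      in _ , run-loop p refl r l , s≤s (begin
        size (state γ b (x ∷ xs)) + (s + (t + u))
          ≤⟨ +-mono-≤ now (+-mono-≤ (≤-trans s≤ (eval-mono (bound test) now))
               (+-mono-≤ (≤-trans t≤ (eval-mono (bound body) now)) u≤)) ⟩
        S + (eval (bound test) S + (eval (bound body) S + suc (length xs) * eval turn S))
          ≡⟨ regroup S (eval (bound test) S) (eval (bound body) S) _ ⟩
        S + (eval (bound test) S + eval (bound body) S) + suc (length xs) * eval turn S ∎)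
      where
      open ≤-Reasoning
      regroup : ∀ a b c d → a + (b + (c + d)) ≡ a + (b + c) + d
      regroup = solve-∀

    looping : _⟿_ {Σ Γ (List ∘ X)} (λ (γ , xs) → state γ (b₀ γ) xs)
                                     (λ (γ , xs) → state γ (foldl (step γ) (b₀ γ) xs) [])
    looping = computes loop (var ⊗ turn ⊚ stateBound) λ (γ , xs) →
      let t , l , t≤ = loop-runs γ _ (b₀ γ) xs (small γ xs) in
      t , l , ≤-trans t≤ (*-monoˡ-≤ (eval (turn ⊚ stateBound) (size (state γ (b₀ γ) xs))) (long γ xs))
      where
      open ≤-Reasoning
      -- Two pair nodes, the environment, the accumulator (by `q`) and the remaining list.
      stateBound : Poly
      stateBound = con 1 ⊕ (var ⊕ (con 1 ⊕ (q ⊕ var)))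

      input≤ : ∀ γ xs → size (env γ ∙ encodeList (encodeX γ) xs) ≤ size (state γ (b₀ γ) xs)
      input≤ γ xs = s≤s (+-monoʳ-≤ (size (env γ))
        (≤-trans (m≤n+m _ (size (encodeB γ (b₀ γ)))) (n≤1+n _)))

      long : ∀ γ xs → suc (length xs) ≤ size (state γ (b₀ γ) xs)
      long γ xs = ≤-trans (length<size (encodeX γ) xs)
        (≤-trans (≤-trans (m≤n+m _ (size (env γ))) (n≤1+n _)) (input≤ γ xs))

      small : ∀ γ xs ys zs → ys ++ zs ≡ xs →
        size (state γ (foldl (step γ) (b₀ γ) ys) zs) ≤ eval stateBound (size (state γ (b₀ γ) xs))
      small γ _ ys zs refl = s≤s (+-mono-≤ (≤-trans (m≤m+n _ _) (n≤1+n _)) (s≤s (+-mono-≤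
        (≤-trans (fold≤q γ ys) (eval-mono q
          (≤-trans (s≤s (+-monoʳ-≤ (size (env γ)) (size-prefix (encodeX γ) ys zs)))
                   (input≤ γ (ys ++ zs)))))
        (≤-trans (size-suffix ys) (≤-trans (≤-trans (m≤n+m _ (size (env γ))) (n≤1+n _))
                                            (input≤ γ (ys ++ zs)))))))
        where
        size-suffix : ∀ ys → size (encodeList (encodeX γ) zs) ≤ size (encodeList (encodeX γ) (ys ++ zs))
        size-suffix []       = ≤-refl
        size-suffix (y ∷ ys) = ≤-trans (size-suffix ys)
          (≤-trans (m≤n+m _ (size (encodeX γ y))) (n≤1+n _))

  foldl⟿ : _⟿_ {Σ Γ (List ∘ X)} (λ (γ , xs) → env γ ∙ encodeList (encodeX γ) xs)
                                  (λ (γ , xs) → encodeB γ (foldl (step γ) (b₀ γ) xs))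
  foldl⟿ = fst⟿ ∥ (fst⟿ ▹ (init at proj₁)) ∥ snd⟿ ▹ looping ▹ π₁ snd⟿

-- The order of the jobs

infix 4 _≺_

_≺_ : Job → Job → Set
j ≺ k = Job.b j ℚ.≤ Job.ℓ k × Job.r j ℚ.≤ Job.a k

≺-trans : ∀ {i j k} → i ≺ j → j ≺ k → i ≺ k
≺-trans {j = j} (b≤ℓ , r≤a) (b≤ℓ′ , r≤a′) =
  ℚ.≤-trans b≤ℓ (ℚ.≤-trans (Job.ℓ≤a j) (ℚ.≤-trans (ℚ.<⇒≤ (Job.a<b j)) b≤ℓ′)) ,
  ℚ.≤-trans r≤a (ℚ.≤-trans (ℚ.<⇒≤ (Job.a<b j)) (ℚ.≤-trans (Job.b≤r j) r≤a′))

≺⇒a<a : ∀ {j k} → j ≺ k → Job.a j ℚ.< Job.a k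
≺⇒a<a {j} (_ , r≤a) = ℚ.<-≤-trans (Job.a<b j) (ℚ.≤-trans (Job.b≤r j) r≤a)

≺-irrefl : ∀ {j} → ¬ j ≺ j
≺-irrefl {j} j≺j = ℚ.<-irrefl refl (≺⇒a<a {j} {j} j≺j)

infix 4 _≺ᵇ_

_≺ᵇ_ : Job → Job → Bool
j ≺ᵇ k = (Job.b j ℚ.≤ᵇ Job.ℓ k) ∧ (Job.r j ℚ.≤ᵇ Job.a k)

≺ᵇ⇒≺ : ∀ {j k} → T (j ≺ᵇ k) → j ≺ k
≺ᵇ⇒≺ {j} {k} t = let p , q = to (T-∧ {Job.b j ℚ.≤ᵇ Job.ℓ k}) t in ℚ.≤ᵇ⇒≤ p , ℚ.≤ᵇ⇒≤ q

≺⇒≺ᵇ : ∀ {j k} → j ≺ k → T (j ≺ᵇ k)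
≺⇒≺ᵇ (p , q) = from T-∧ (ℚ.≤⇒≤ᵇ p , ℚ.≤⇒≤ᵇ q)

Compatible : Job → Job → Set
Compatible j k = Empty (red j ∩ whole k) × Empty (red k ∩ whole j)

≺⇒compatible : ∀ {j k} → j ≺ k → Compatible j k
≺⇒compatible (b≤ℓ , r≤a) =
  (λ x ((_ , x<b) , (ℓ≤x , _)) → ℚ.<-irrefl refl (ℚ.<-≤-trans x<b (ℚ.≤-trans b≤ℓ ℓ≤x))) ,
  (λ x ((a≤x , _) , (_ , x<r)) → ℚ.<-irrefl refl (ℚ.<-≤-trans x<r (ℚ.≤-trans r≤a a≤x)))

-- If both inequalities failed, the larger of the two left endpoints would lie in both intervals, as
-- neither interval is empty.
red∩whole-empty : ∀ j k → Empty (red j ∩ whole k) → Job.b j ℚ.≤ Job.ℓ k ⊎ Job.r k ℚ.≤ Job.a j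
red∩whole-empty j k empty with Job.b j ℚ.≤? Job.ℓ k | Job.r k ℚ.≤? Job.a j | ℚ.≤-total (Job.ℓ k) (Job.a j)
... | yes b≤ℓ | _       | _        = inj₁ b≤ℓ
... | no _    | yes r≤a | _        = inj₂ r≤a
... | no _    | no r≰a  | inj₁ ℓ≤a =
  contradiction ((ℚ.≤-refl , Job.a<b j) , (ℓ≤a , ℚ.≰⇒> r≰a)) (empty (Job.a j))
... | no b≰ℓ  | no _    | inj₂ a≤ℓ =
  contradiction ((a≤ℓ , ℚ.≰⇒> b≰ℓ) ,
                 (ℚ.≤-refl , ℚ.≤-<-trans (Job.ℓ≤a k) (ℚ.<-≤-trans (Job.a<b k) (Job.b≤r k))))
                (empty (Job.ℓ k))

-- Two of the four combinations are the two orders. Each of the others closes a cycle of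
-- inequalities that runs strictly through both red intervals.
compatible⇒comparable : ∀ j k → Compatible j k → j ≺ k ⊎ k ≺ j
compatible⇒comparable j k (jk , kj) with red∩whole-empty j k jk | red∩whole-empty k j kj
... | inj₁ bj≤ℓk | inj₂ rj≤ak = inj₁ (bj≤ℓk , rj≤ak)
... | inj₂ rk≤aj | inj₁ bk≤ℓj = inj₂ (bk≤ℓj , rk≤aj)
... | inj₁ bj≤ℓk | inj₁ bk≤ℓj = ⊥-elim (ℚ.<-irrefl refl
  (ℚ.<-≤-trans (Job.a<b j) (ℚ.≤-trans bj≤ℓk (ℚ.≤-trans (Job.ℓ≤a k)
    (ℚ.≤-trans (ℚ.<⇒≤ (Job.a<b k)) (ℚ.≤-trans bk≤ℓj (Job.ℓ≤a j)))))))
... | inj₂ rk≤aj | inj₂ rj≤ak = ⊥-elim (ℚ.<-irrefl refl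
  (ℚ.<-≤-trans (Job.a<b j) (ℚ.≤-trans (Job.b≤r j) (ℚ.≤-trans rj≤ak
    (ℚ.≤-trans (ℚ.<⇒≤ (Job.a<b k)) (ℚ.≤-trans (Job.b≤r k) rk≤aj))))))

-- Subsets of jobs, their weight and cardinality

T-ext : ∀ {a b} → (T a → T b) → (T b → T a) → a ≡ b
T-ext {false} {false} _ _ = refl
T-ext {true}  {true}  _ _ = refl
T-ext {false} {true}  _ g = ⊥-elim (g _)
T-ext {true}  {false} f _ = ⊥-elim (f _)

subset-ext : ∀ {n} {S S′ : Subset n} → (∀ i → lookup S i ≡ lookup S′ i) → S ≡ S′
subset-ext {S = []}     {[]}     eq = refl
subset-ext {S = x ∷ S}  {y ∷ S′} eq = cong₂ _∷_ (eq zero) (subset-ext (eq ∘ suc))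

-- A relation rather than an operation, because it is met from both sides: when the top is removed
-- from a feasible set and when a job is put on a chain.
record Adds {n} (k : Fin n) (S S′ : Subset n) : Set where
  constructor adds
  field
    new  : lookup S k ≡ false
    is   : lookup S′ k ≡ true
    same : ∀ i → i ≢ k → lookup S′ i ≡ lookup S i

adds-tail : ∀ {n} {k : Fin n} {x y S S′} → Adds (suc k) (x ∷ S) (y ∷ S′) → Adds k S S′
adds-tail (adds new is same) = adds new is λ i i≢k → same (suc i) λ { refl → i≢k refl }

totalWeight-adds : ∀ {n} (js : Vec Job n) {k S S′} → Adds k S S′ →
                   totalWeight js S′ ≡ Job.w (lookup js k) ℚ.+ totalWeight js S
totalWeight-adds (j ∷ js) {zero} {false ∷ S} {true ∷ S′} (adds _ _ same) =
  cong (λ R → Job.w j ℚ.+ totalWeight js R) (subset-ext λ i → same (suc i) λ ())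
totalWeight-adds (j ∷ js) {suc k} {x ∷ S} {y ∷ S′} ad@(adds _ _ same) with same zero (λ ())
totalWeight-adds (j ∷ js) {suc k} {false ∷ S} {_ ∷ S′} ad | refl = totalWeight-adds js (adds-tail ad)
totalWeight-adds (j ∷ js) {suc k} {true ∷ S}  {_ ∷ S′} ad | refl = begin
  Job.w j ℚ.+ totalWeight js S′                              ≡⟨ cong (Job.w j ℚ.+_) (totalWeight-adds js (adds-tail ad)) ⟩
  Job.w j ℚ.+ (Job.w (lookup js k) ℚ.+ totalWeight js S)     ≡⟨ ℚ.+-assoc (Job.w j) _ _ ⟨
  Job.w j ℚ.+ Job.w (lookup js k) ℚ.+ totalWeight js S       ≡⟨ cong (ℚ._+ totalWeight js S) (ℚ.+-comm (Job.w j) _) ⟩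
  Job.w (lookup js k) ℚ.+ Job.w j ℚ.+ totalWeight js S       ≡⟨ ℚ.+-assoc (Job.w (lookup js k)) _ _ ⟩
  Job.w (lookup js k) ℚ.+ (Job.w j ℚ.+ totalWeight js S)     ∎
  where open ≡-Reasoning

card-adds : ∀ {n} {k : Fin n} {S S′} → Adds k S S′ → card S′ ≡ suc (card S)
card-adds {k = zero} {false ∷ S} {true ∷ S′} (adds _ _ same) =
  cong (λ R → suc (card R)) (subset-ext {S = S′} {S} λ i → same (suc i) λ ())
card-adds {k = suc k} {x ∷ S} {y ∷ S′} ad@(adds _ _ same) with same zero (λ ())
card-adds {k = suc k} {false ∷ S} {_ ∷ S′} ad | refl = card-adds (adds-tail ad)
card-adds {k = suc k} {true ∷ S}  {_ ∷ S′} ad | refl = cong suc (card-adds (adds-tail ad))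

remove-adds : ∀ {n} {k : Fin n} {S} → k ∈ S → Adds k (S [ k ]≔ outside) S
remove-adds {k = k} {S} k∈S = adds (lookup∘update k S outside) ([]=⇒lookup k∈S)
  (λ i i≢k → sym (lookup∘update′ i≢k S outside))

∈-remove⁻ : ∀ {n} {k i : Fin n} {S} → i ∈ S [ k ]≔ outside → i ≢ k × i ∈ S
∈-remove⁻ {k = k} {i} {S} i∈ = i≢k ,
  lookup⇒[]= i S (trans (sym (lookup∘update′ i≢k S outside)) ([]=⇒lookup i∈))
  where
  i≢k : i ≢ k
  i≢k refl with trans (sym (lookup∘update k S outside)) ([]=⇒lookup i∈)
  ... | ()

totalWeight-empty : ∀ {n} (js : Vec Job n) {S} → ¬ Nonempty S → totalWeight js S ≡ 0ℚ
totalWeight-empty []       {[]}        _ = refl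
totalWeight-empty (j ∷ js) {true ∷ S}  ∅ = contradiction (zero , here) ∅
totalWeight-empty (j ∷ js) {false ∷ S} ∅ =
  totalWeight-empty js λ (i , i∈S) → ∅ (suc i , there i∈S)

argmax : ∀ {n} (f : Fin n → ℚ) {S : Subset n} → Nonempty S →
         ∃[ k ] k ∈ S × (∀ i → i ∈ S → f i ℚ.≤ f k)
argmax f {x ∷ S} ne with nonempty? S
argmax f {true ∷ S} _ | no ∅ = zero , here , λ where
  zero    _                        → ℚ.≤-refl
  (suc i) (there i∈) → contradiction (i , i∈) ∅
argmax f {false ∷ S} (suc i , there i∈) | no ∅ = contradiction (i , i∈) ∅
argmax f {x ∷ S} _ | yes ne with argmax (f ∘ suc) ne
argmax f {false ∷ S} _ | yes _ | k , k∈ , max = suc k , there k∈ , λ where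
  (suc i) (there i∈) → max i i∈
argmax f {true ∷ S} _ | yes _ | k , k∈ , max with ℚ.≤-total (f zero) (f (suc k))
... | inj₁ 0≤k = suc k , there k∈ , λ where
  zero    _                        → 0≤k
  (suc i) (there i∈) → max i i∈
... | inj₂ k≤0 = zero , here , λ where
  zero    _                        → ℚ.≤-refl
  (suc i) (there i∈) → ℚ.≤-trans (max i i∈) k≤0

-- Left folds over lists

module _ {A : Set} where

  foldl-∧⁻ : (p : A → Bool) → ∀ b xs → T (foldl (λ c x → c ∧ p x) b xs) → T b × All (T ∘ p) xs
  foldl-∧⁻ p b []       t = t , []
  foldl-∧⁻ p b (x ∷ xs) t =
    let tb∧px , all = foldl-∧⁻ p (b ∧ p x) xs t
        tb , tpx    = to T-∧ tb∧px
    in  tb , tpx ∷ all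

  foldl-∧⁺ : (p : A → Bool) → ∀ {b xs} → T b → All (T ∘ p) xs → T (foldl (λ c x → c ∧ p x) b xs)
  foldl-∧⁺ p tb []          = tb
  foldl-∧⁺ p tb (tpx ∷ all) = foldl-∧⁺ p (from T-∧ (tb , tpx)) all

  foldl-∨⁻ : (p : A → Bool) → ∀ b xs → T (foldl (λ c x → c ∨ p x) b xs) → T b ⊎ Any (T ∘ p) xs
  foldl-∨⁻ p b []       t = inj₁ t
  foldl-∨⁻ p b (x ∷ xs) t with foldl-∨⁻ p (b ∨ p x) xs t
  ... | inj₂ any  = inj₂ (there any)
  ... | inj₁ tb∨px with to T-∨ tb∨px
  ... | inj₁ tb   = inj₁ tb
  ... | inj₂ tpx  = inj₂ (here tpx)

  foldl-∨⁺ : (p : A → Bool) → ∀ {b xs} → T b ⊎ Any (T ∘ p) xs → T (foldl (λ c x → c ∨ p x) b xs)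
  foldl-∨⁺ p {xs = []}     (inj₁ tb)          = tb
  foldl-∨⁺ p {b} {x ∷ xs}  (inj₁ tb)          = foldl-∨⁺ p {xs = xs} (inj₁ (from T-∨ (inj₁ tb)))
  foldl-∨⁺ p {b} {x ∷ xs}  (inj₂ (here tpx))  =
    foldl-∨⁺ p {xs = xs} (inj₁ (from (T-∨ {b}) (inj₂ tpx)))
  foldl-∨⁺ p {b} {x ∷ xs}  (inj₂ (there any)) = foldl-∨⁺ p (inj₂ any)

  module _ {B : Set} (f : A → B) where

    -- That is `reverse (map f xs) ++ ys`, written as the left fold that a loop carries out.
    consAll : List B → List A → List B
    consAll = foldl λ ys x → f x ∷ ys

    consAll-all : ∀ {P : B → Set} {ys} xs → All P ys → (∀ x → P (f x)) → All P (consAll ys xs)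
    consAll-all []       pys pf = pys
    consAll-all (x ∷ xs) pys pf = consAll-all xs (pf x ∷ pys) pf

    ∈-consAll⁺ˡ : ∀ {y ys} xs → y ∈ₗ ys → y ∈ₗ consAll ys xs
    ∈-consAll⁺ˡ []       y∈ = y∈
    ∈-consAll⁺ˡ (x ∷ xs) y∈ = ∈-consAll⁺ˡ xs (there y∈)

    ∈-consAll⁺ʳ : ∀ {x ys xs} → x ∈ₗ xs → f x ∈ₗ consAll ys xs
    ∈-consAll⁺ʳ {xs = _ ∷ xs} (here refl) = ∈-consAll⁺ˡ xs (here refl)
    ∈-consAll⁺ʳ {xs = _ ∷ xs} (there x∈)  = ∈-consAll⁺ʳ x∈

    length-consAll : ∀ ys xs → length (consAll ys xs) ≡ length ys + length xs
    length-consAll ys []       = sym (+-identityʳ _)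
    length-consAll ys (x ∷ xs) =
      trans (length-consAll (f x ∷ ys) xs) (sym (+-suc (length ys) (length xs)))

  comparable : ∀ {R : A → A → Set} {xs x y} → AllPairs R xs → x ∈ₗ xs → y ∈ₗ xs → x ≢ y → R x y ⊎ R y x
  comparable (rs ∷ _) (here refl) (here refl) x≢y = contradiction refl x≢y
  comparable (rs ∷ _) (here refl) (there y∈)  _   = inj₁ (All.lookup rs y∈)
  comparable (rs ∷ _) (there x∈)  (here refl) _   = inj₂ (All.lookup rs x∈)
  comparable (_ ∷ ap) (there x∈)  (there y∈)  x≢y = comparable ap x∈ y∈ x≢y

-- The dynamic program

-- Descending, because the loop that numbers the input jobs pushes them onto a list and so reverses
-- them. A later pass with `consAll` restores the input order for the answer.
indices : ∀ n → List (Fin n)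
indices n = reverse (allFin n)

-- Two inequalities, since `leq` is the only comparison of the machine.
_≡ᶠ_ : ∀ {n} → Fin n → Fin n → Bool
i ≡ᶠ j = (toℕ i ≤ᵇ toℕ j) ∧ (toℕ j ≤ᵇ toℕ i)

≡ᶠ⇒≡ : ∀ {n} {i j : Fin n} → T (i ≡ᶠ j) → i ≡ j
≡ᶠ⇒≡ {i = i} {j} t = let i≤j , j≤i = to (T-∧ {toℕ i ≤ᵇ toℕ j}) t in
  toℕ-injective (≤-antisym (≤ᵇ⇒≤ (toℕ i) (toℕ j) i≤j) (≤ᵇ⇒≤ (toℕ j) (toℕ i) j≤i))

≡ᶠ-refl : ∀ {n} (i : Fin n) → T (i ≡ᶠ i)
≡ᶠ-refl i = from T-∧ (≤⇒≤ᵇ (≤-refl {toℕ i}) , ≤⇒≤ᵇ (≤-refl {toℕ i}))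

module DynamicProgram {n} (js : Vec Job n) where

  job : Fin n → Job
  job = lookup js

  Chain : Set
  Chain = List (Fin n)

  below : Fin n → Chain → Bool
  below k = foldl (λ b j → b ∧ (job j ≺ᵇ job k)) true

  member : Chain → Fin n → Bool
  member c i = foldl (λ b j → b ∨ (i ≡ᶠ j)) false c

  weight : Chain → ℚᵘ
  weight = foldl (λ q i → q ℚᵘ.+ toℚᵘ (Job.w (job i))) 0ℚᵘ

  better : (Chain → Bool) → Chain → Chain → Chain
  better p c d = if p d ∧ (weight c ℚᵘ.≤ᵇ weight d) then d else c

  -- `[]` is a safe default: it lies below every job and has weight zero.
  best : (Chain → Bool) → List Chain → Chain
  best p = foldl (better p) []

  -- The old table is replaced, not enlarged, so every round leaves exactly n + 1 chains.
  extend : List Chain → List Chain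
  extend tab = consAll (λ k → k ∷ best (below k) tab) ([] ∷ []) (indices n)

  -- The list only counts the rounds.
  table : Chain → List Chain
  table = foldl (λ tab _ → extend tab) ([] ∷ [])

  optimum : Chain
  optimum = best (λ _ → true) (table (indices n))

  answer : Chain → Subset n
  answer c = tabulate (member c)

  Descending : Chain → Set
  Descending = AllPairs λ k j → job j ≺ job k

  -- `weight` is what the machine adds up; this is the same sum in ℚ, nested to match
  -- `totalWeight-adds`.
  total : Chain → ℚ
  total = foldr (λ i q → Job.w (job i) ℚ.+ q) 0ℚ

  weight-total : ∀ c → weight c ≃ toℚᵘ (total c)
  weight-total c = ℚᵘ.≃-trans (go 0ℚᵘ c) (ℚᵘ.+-identityˡ _)
    where
    go : ∀ q c → foldl (λ q i → q ℚᵘ.+ toℚᵘ (Job.w (job i))) q c ≃ q ℚᵘ.+ toℚᵘ (total c)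
    go q []      = ℚᵘ.≃-sym (ℚᵘ.+-identityʳ q)
    go q (i ∷ c) = begin
      foldl _ (q ℚᵘ.+ w) c               ≈⟨ go (q ℚᵘ.+ w) c ⟩
      q ℚᵘ.+ w ℚᵘ.+ toℚᵘ (total c)       ≈⟨ ℚᵘ.+-assoc q w _ ⟩
      q ℚᵘ.+ (w ℚᵘ.+ toℚᵘ (total c))     ≈⟨ ℚᵘ.+-congʳ q (ℚ.toℚᵘ-homo-+ (Job.w (job i)) (total c)) ⟨
      q ℚᵘ.+ toℚᵘ (total (i ∷ c))        ∎
      where
      open import Relation.Binary.Reasoning.Setoid ℚᵘ.≃-setoid
      w = toℚᵘ (Job.w (job i))

  weight≤⇒total≤ : ∀ c d → weight c ℚᵘ.≤ weight d → total c ℚ.≤ total d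
  weight≤⇒total≤ c d c≤d = ℚ.toℚᵘ-cancel-≤
    (ℚᵘ.≤-respˡ-≃ (weight-total c) (ℚᵘ.≤-respʳ-≃ (weight-total d) c≤d))

  better-≥ : ∀ p c d → total c ℚ.≤ total (better p c d) × (T (p d) → total d ℚ.≤ total (better p c d))
  better-≥ p c d with p d | weight c ℚᵘ.≤ᵇ weight d in eq
  ... | false | _     = ℚ.≤-refl , λ ()
  ... | true  | true  = weight≤⇒total≤ c d (ℚᵘ.≤ᵇ⇒≤ (from T-≡ eq)) , λ _ → ℚ.≤-refl
  ... | true  | false = ℚ.≤-refl , λ _ →
    [ (λ c≤d → ⊥-elim (subst T eq (ℚᵘ.≤⇒≤ᵇ c≤d))) , weight≤⇒total≤ d c ]′ (ℚᵘ.≤-total (weight c) (weight d))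

  module _ (p : Chain → Bool) where

    foldl-better-≥ : ∀ c tab → total c ℚ.≤ total (foldl (better p) c tab)
    foldl-better-≥ c []        = ℚ.≤-refl
    foldl-better-≥ c (d ∷ tab) = ℚ.≤-trans (proj₁ (better-≥ p c d)) (foldl-better-≥ (better p c d) tab)

    best-≥ : ∀ {d} tab → d ∈ₗ tab → T (p d) → total d ℚ.≤ total (best p tab)
    best-≥ = go []
      where
      go : ∀ c {d} tab → d ∈ₗ tab → T (p d) → total d ℚ.≤ total (foldl (better p) c tab)
      go c (d ∷ tab) (here refl) tpd =
        ℚ.≤-trans (proj₂ (better-≥ p c d) tpd) (foldl-better-≥ (better p c d) tab)
      go c (d ∷ tab) (there d∈)  tpd = go (better p c d) tab d∈ tpd

    -- Selection never builds a chain: the result is the initial `[]` or an entry of `tab` that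
    -- passed the test.
    best-elim : (P : Chain → Set) → ∀ tab → P [] → (∀ d → d ∈ₗ tab → T (p d) → P d) → P (best p tab)
    best-elim P tab P[] Pd = go [] tab P[] Pd
      where
      P-better : ∀ c d → P c → (T (p d) → P d) → P (better p c d)
      P-better c d Pc Pd with p d | weight c ℚᵘ.≤ᵇ weight d
      ... | false | _     = Pc
      ... | true  | false = Pc
      ... | true  | true  = Pd _

      go : ∀ c tab → P c → (∀ d → d ∈ₗ tab → T (p d) → P d) → P (foldl (better p) c tab)
      go c []        Pc Pd = Pc
      go c (d ∷ tab) Pc Pd = go (better p c d) tab (P-better c d Pc (Pd d (here refl)))
                                (λ e e∈ → Pd e (there e∈))

  table-elim : (P : List Chain → ℕ → Set) → P ([] ∷ []) 0 →
               (∀ tab t → P tab t → P (extend tab) (suc t)) → ∀ xs → P (table xs) (length xs)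
  table-elim P P₀ step xs = go ([] ∷ []) 0 xs P₀
    where
    go : ∀ tab t (ys : Chain) → P tab t → P (foldl (λ tab _ → extend tab) tab ys) (t + length ys)
    go tab t []       Ptab = subst (P tab) (sym (+-identityʳ t)) Ptab
    go tab t (y ∷ ys) Ptab = subst (P _) (sym (+-suc t (length ys)))
      (go (extend tab) (suc t) ys (step tab t Ptab))

  best-below : ∀ k tab → All (λ j → job j ≺ job k) (best (below k) tab)
  best-below k tab = best-elim (below k) (All λ j → job j ≺ job k) tab []
    λ d _ t → All.map (λ {j} → ≺ᵇ⇒≺ {job j} {job k}) (proj₂ (foldl-∧⁻ (λ j → job j ≺ᵇ job k) true d t))

  table-descending : ∀ xs → All Descending (table xs)
  table-descending = table-elim (λ tab _ → All Descending tab) ([] ∷ []) λ tab _ desc →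
    consAll-all _ (indices n) ([] ∷ []) λ k →
      best-below k tab ∷ best-elim (below k) Descending tab [] (λ d d∈ _ → All.lookup desc d∈)

  table-length : ∀ xs → All (λ c → length c ≤ length xs) (table xs)
  table-length = table-elim (λ tab t → All (λ c → length c ≤ t) tab) (z≤n ∷ []) λ tab t short →
    consAll-all _ (indices n) (z≤n ∷ []) λ k →
      s≤s (best-elim (below k) (λ c → length c ≤ t) tab z≤n (λ d d∈ _ → All.lookup short d∈))

  ∈-indices : ∀ i → i ∈ₗ indices n
  ∈-indices i = reverse⁺ (∈-allFin i)

  []∈extend : ∀ tab → [] ∈ₗ extend tab
  []∈extend tab = ∈-consAll⁺ˡ _ (indices n) (here refl)

  -- The last clause carries the induction: the top removed from a larger set is one such `k`, and
  -- thus may be put on `c`.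
  DominatedIn : List Chain → Subset n → Set
  DominatedIn tab R = ∃[ c ]
    c ∈ₗ tab × totalWeight js R ℚ.≤ total c ×
    (∀ k → (∀ j → j ∈ R → job j ≺ job k) → All (λ j → job j ≺ job k) c)

  Dominates : List Chain → ℕ → Set
  Dominates tab t = [] ∈ₗ tab × (∀ R → Feasible js R → card R ≤ t → DominatedIn tab R)

  -- Take a job with the largest `a`. Any other member is comparable with it and cannot lie above
  -- it, as `≺` strictly increases `a`.
  feasible⇒top : ∀ {R} → Feasible js R → Nonempty R →
                 ∃[ k ] k ∈ R × (∀ j → j ∈ R → j ≢ k → job j ≺ job k)
  feasible⇒top feas ne with argmax (Job.a ∘ job) ne
  ... | k , k∈ , max = k , k∈ , λ j j∈ j≢k →
    [ id , (λ k≺j → ⊥-elim (ℚ.<-irrefl refl (ℚ.<-≤-trans (≺⇒a<a {job k} {job j} k≺j) (max j j∈)))) ]′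
    (compatible⇒comparable (job j) (job k) (feas j k j∈ k∈ j≢k))

  dominates-empty : ∀ {tab R} → [] ∈ₗ tab → ¬ Nonempty R → DominatedIn tab R
  dominates-empty []∈ ∅ = [] , []∈ , ℚ.≤-reflexive (totalWeight-empty js ∅) , λ _ _ → []

  -- Remove the top `m` of the set. A chain `c` dominating the rest lies below `m`, so it competes
  -- in `best (below m) tab`, and the winner is at least as heavy.
  extend-dominates : ∀ tab t → Dominates tab t → Dominates (extend tab) (suc t)
  extend-dominates tab t (_ , dom) = []∈extend tab , λ R feas card≤ → go R feas card≤ (nonempty? R)
    where
    go : ∀ R → Feasible js R → card R ≤ suc t → Dec (Nonempty R) → DominatedIn (extend tab) R
    go R feas card≤ (no ∅)  = dominates-empty ([]∈extend tab) ∅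
    go R feas card≤ (yes ne) with feasible⇒top feas ne
    ... | m , m∈ , top with dom (R [ m ]≔ outside)
            (λ i j i∈ j∈ → feas i j (proj₂ (∈-remove⁻ i∈)) (proj₂ (∈-remove⁻ j∈)))
            (≤-pred (subst (_≤ suc t) (card-adds (remove-adds m∈)) card≤))
    ... | c , c∈ , R≤c , c≺ =
      m ∷ best (below m) tab ,
      ∈-consAll⁺ʳ _ (∈-indices m) ,
      ℚ.≤-trans (ℚ.≤-reflexive (totalWeight-adds js (remove-adds m∈)))
        (ℚ.+-monoʳ-≤ (Job.w (job m)) (ℚ.≤-trans R≤c (best-≥ (below m) tab c∈ c-below))) ,
      -- A job above the set is above its member `m`, hence above all that lies below `m`.
      (λ k R≺k → R≺k m m∈ ∷ All.map (λ {j} j≺m → ≺-trans {job j} {job m} {job k} j≺m (R≺k m m∈)) (best-below m tab))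
      where
      c-below : T (below m c)
      c-below = foldl-∧⁺ (λ j → job j ≺ᵇ job m) _ (All.map (λ {j} → ≺⇒≺ᵇ {job j} {job m})
        (c≺ m (λ j j∈ → let j≢m , j∈R = ∈-remove⁻ j∈ in top j j∈R j≢m)))

  table-dominates : ∀ xs → Dominates (table xs) (length xs)
  table-dominates = table-elim Dominates
    (here refl , λ T _ card≤0 → dominates-empty (here refl) λ (i , i∈) →
      contradiction (subst (_≤ 0) (card-adds (remove-adds i∈)) card≤0) λ ())
    extend-dominates

  optimum-descending : Descending optimum
  optimum-descending = best-elim _ Descending (table (indices n)) []
    λ d d∈ _ → All.lookup (table-descending (indices n)) d∈

  ∈⇒member : ∀ {c i} → i ∈ₗ c → T (member c i)
  ∈⇒member {i = i} i∈ = foldl-∨⁺ (i ≡ᶠ_) {false} (inj₂ (Any.map (λ { refl → ≡ᶠ-refl i }) i∈))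

  member⇒∈ : ∀ {c i} → T (member c i) → i ∈ₗ c
  member⇒∈ {c} {i} t with foldl-∨⁻ (i ≡ᶠ_) false c t
  ... | inj₂ any = Any.map ≡ᶠ⇒≡ any

  ∈-answer⁻ : ∀ {c i} → i ∈ answer c → i ∈ₗ c
  ∈-answer⁻ {c} {i} i∈ = member⇒∈ (from T-≡ (trans (sym (lookup∘tabulate (member c) i)) ([]=⇒lookup i∈)))

  answer-feasible : ∀ {c} → Descending c → Feasible js (answer c)
  answer-feasible desc j k j∈ k∈ j≢k with comparable desc (∈-answer⁻ j∈) (∈-answer⁻ k∈) j≢k
  ... | inj₁ k≺j = let p , q = ≺⇒compatible {job k} {job j} k≺j in q , p
  ... | inj₂ j≺k = ≺⇒compatible {job j} {job k} j≺k

  answer-adds : ∀ {k c} → ¬ k ∈ₗ c → Adds k (answer c) (answer (k ∷ c))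
  answer-adds {k} {c} k∉c = adds
    (trans (lookup∘tabulate (member c) k) (T-ext (k∉c ∘ member⇒∈) λ ()))
    (trans (lookup∘tabulate (member (k ∷ c)) k) (to T-≡ (∈⇒member {k ∷ c} (here refl))))
    (λ i i≢k → trans (lookup∘tabulate (member (k ∷ c)) i) (trans
      (T-ext (λ t → ∈⇒member (drop i≢k (member⇒∈ {k ∷ c} t))) (λ t → ∈⇒member {k ∷ c} (there (member⇒∈ t))))
      (sym (lookup∘tabulate (member c) i))))
    where
    drop : ∀ {i} → i ≢ k → i ∈ₗ k ∷ c → i ∈ₗ c
    drop i≢k (here i≡k) = contradiction i≡k i≢k
    drop i≢k (there i∈) = i∈

  -- A descending chain never repeats a job, by irreflexivity, so turning it into a subset loses no
  -- weight.
  totalWeight-answer : ∀ {c} → Descending c → totalWeight js (answer c) ≡ total c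
  totalWeight-answer {[]}    []           = totalWeight-empty js λ (i , i∈) → contradiction (∈-answer⁻ {[]} i∈) λ ()
  totalWeight-answer {k ∷ c} (k≻ ∷ desc) = trans
    (totalWeight-adds js (answer-adds λ k∈ → ≺-irrefl {job k} (All.lookup k≻ k∈)))
    (cong (Job.w (job k) ℚ.+_) (totalWeight-answer desc))

  optimum-maximum : MaximumWeightFeasible js (answer optimum)
  optimum-maximum = answer-feasible optimum-descending , λ T feas →
    let c , c∈ , T≤c , _ = proj₂ (table-dominates (indices n)) T feas
          -- `indices n` has length n, so the number of rounds bounds the cardinality of every
          -- subset.
          (≤-trans (∣p∣≤n T) (≤-reflexive (sym (trans (length-reverse (allFin n)) (length-tabulate id)))))
    in  ℚ.≤-trans T≤c (ℚ.≤-trans (best-≥ _ (table (indices n)) c∈ _)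
          (ℚ.≤-reflexive (sym (totalWeight-answer optimum-descending))))

-- Running the dynamic program

encodeℚᵘ : ℚᵘ → Data
encodeℚᵘ p = atom (↥ p) ∙ atom (↧ p)

-- The machine reads the reduced fractions of the input as unnormalised ones without any conversion.
encodeℚ-toℚᵘ : ∀ p → encodeℚ p ≡ encodeℚᵘ (toℚᵘ p)
encodeℚ-toℚᵘ p@record{} = refl

≤ᵇᵘ⟿ : {p q : Γ → ℚᵘ} → f ⟿ encodeℚᵘ ∘ p → f ⟿ encodeℚᵘ ∘ q → f ⟿ (λ γ → fromBool (p γ ℚᵘ.≤ᵇ q γ))
≤ᵇᵘ⟿ P Q = ≤ᵇ⟿ (*⟿ (π₁ P) (π₂ Q)) (*⟿ (π₁ Q) (π₂ P))

≤ᵇℚ⟿ : {p q : Γ → ℚ} → f ⟿ encodeℚ ∘ p → f ⟿ encodeℚ ∘ q → f ⟿ (λ γ → fromBool (p γ ℚ.≤ᵇ q γ))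
≤ᵇℚ⟿ P Q = ≤ᵇ⟿ (*⟿ (π₁ P) (π₂ Q)) (*⟿ (π₁ Q) (π₂ P))

+ᵘ⟿ : {p q : Γ → ℚᵘ} → f ⟿ encodeℚᵘ ∘ p → f ⟿ encodeℚᵘ ∘ q → f ⟿ (λ γ → encodeℚᵘ (p γ ℚᵘ.+ q γ))
+ᵘ⟿ {p = p} {q} P Q = recast (λ γ → eq (p γ) (q γ))
  (+⟿ (*⟿ (π₁ P) (π₂ Q)) (*⟿ (π₁ Q) (π₂ P)) ∥ *⟿ (π₂ P) (π₂ Q))
  where
  eq : ∀ p q → atom (↥ p ℤ.* ↧ q ℤ.+ ↥ q ℤ.* ↧ p) ∙ atom (↧ p ℤ.* ↧ q) ≡ encodeℚᵘ (p ℚᵘ.+ q)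
  eq p@record{} q@record{} = refl

-- Unlike the size, this measure is at worst multiplied by an addition, so that
-- the bit length of a sum grows additively.
height : ℚᵘ → ℕ
height p = suc (∣ ↥ p ∣ + ↧ₙ p)

height-+ : ∀ p q → height (p ℚᵘ.+ q) ≤ height p * height q
height-+ p@(mkℚᵘ m c) q@(mkℚᵘ n d) = begin
  suc (∣ m ℤ.* ↧ q ℤ.+ n ℤ.* ↧ p ∣ + suc c * suc d)
    ≤⟨ s≤s (+-monoˡ-≤ _ (ℤ.∣i+j∣≤∣i∣+∣j∣ (m ℤ.* ↧ q) (n ℤ.* ↧ p))) ⟩
  suc (∣ m ℤ.* ↧ q ∣ + ∣ n ℤ.* ↧ p ∣ + suc c * suc d)
    ≡⟨ cong₂ (λ x y → suc (x + y + suc c * suc d)) (ℤ.abs-* m (↧ q)) (ℤ.abs-* n (↧ p)) ⟩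
  suc (∣ m ∣ * suc d + ∣ n ∣ * suc c + suc c * suc d)
    -- The added terms are those that complete the expanded product of the two heights.
    ≤⟨ m≤m+n _ (∣ m ∣ * ∣ n ∣ + ∣ m ∣ + suc c + ∣ n ∣ + suc d) ⟩
  suc (∣ m ∣ * suc d + ∣ n ∣ * suc c + suc c * suc d) + (∣ m ∣ * ∣ n ∣ + ∣ m ∣ + suc c + ∣ n ∣ + suc d)
    ≡⟨ expand (∣ m ∣) (suc c) (∣ n ∣) (suc d) ⟩
  suc (∣ m ∣ + suc c) * suc (∣ n ∣ + suc d) ∎
  where
  open ≤-Reasoning
  expand : ∀ a b x y → suc (a * y + x * b + b * y) + (a * x + a + b + x + y) ≡ suc (a + b) * suc (x + y)
  expand = solve-∀

log-height≤size : ∀ p → ⌈log₂ height p ⌉ ≤ size (encodeℚᵘ p)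
log-height≤size p = begin
  ⌈log₂ height p ⌉                                   ≤⟨ ⌈log₂⌉-mono-≤ product ⟩
  ⌈log₂ (suc ∣ ↥ p ∣ * suc (↧ₙ p)) ⌉                 ≤⟨ ⌈log₂⌉-*-≤ (suc ∣ ↥ p ∣) (suc (↧ₙ p)) ⟩
  ⌈log₂ suc ∣ ↥ p ∣ ⌉ + ⌈log₂ suc (↧ₙ p) ⌉           ≤⟨ +-mono-≤ (n≤1+n _) (n≤1+n _) ⟩
  size (atom (↥ p)) + size (atom (↧ p))              ≤⟨ n≤1+n _ ⟩
  size (encodeℚᵘ p)                                  ∎
  where
  open ≤-Reasoning
  product : height p ≤ suc ∣ ↥ p ∣ * suc (↧ₙ p)
  product = ≤-trans (m≤m+n _ (∣ ↥ p ∣ * ↧ₙ p)) (≤-reflexive (expand (∣ ↥ p ∣) (↧ₙ p)))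
    where
    expand : ∀ a b → suc (a + b) + a * b ≡ suc a * suc b
    expand = solve-∀

-- The 3 pays for the pair node and the two signs; numerator and denominator contribute one
-- logarithm each.
size≤log-height : ∀ p → size (encodeℚᵘ p) ≤ 3 + (⌈log₂ height p ⌉ + ⌈log₂ height p ⌉)
size≤log-height p = s≤s (≤-trans
  (+-mono-≤ (s≤s (⌈log₂⌉-mono-≤ (s≤s (m≤m+n (∣ ↥ p ∣) (↧ₙ p)))))
            (s≤s (⌈log₂⌉-mono-≤ (s≤s (m≤n+m (↧ₙ p) (∣ ↥ p ∣))))))
  (≤-reflexive (cong suc (+-suc _ _))))

module _ {A : Set} (e : A → Data) where

  size-∈ : ∀ {x xs} → x ∈ₗ xs → size (e x) ≤ size (encodeList e xs)
  size-∈ {xs = y ∷ xs} (here refl) = size-left (e y) (encodeList e xs)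
  size-∈ {xs = y ∷ xs} (there x∈)  = ≤-trans (size-∈ x∈) (size-right (e y) (encodeList e xs))

  size-encodeList : ∀ {S xs} → All (λ x → size (e x) ≤ S) xs → size (encodeList e xs) ≤ suc (length xs * suc S)
  size-encodeList []           = ≤-refl
  size-encodeList {S} {x ∷ xs} (x≤ ∷ xs≤) = s≤s (≤-trans (+-mono-≤ x≤ (size-encodeList xs≤)) (≤-reflexive (+-suc S _)))

-- Tree encodings of jobs, chains and tables, and programs on them

Input : Set
Input = Σ ℕ (Vec Job)

Index : Input → Set
Index (n , _) = Fin n

Chain : Input → Set
Chain I = List (Index I)

-- The trees offer no random access, so a chain carries the data of its jobs. The number identifies
-- a job for `member`, since distinct jobs may have equal data.
entry : (I : Input) → Index I → Data
entry (_ , js) i = atom (ℤ.+ toℕ i) ∙ encodeJob (lookup js i)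

encodeChain : (I : Input) → Chain I → Data
encodeChain I = encodeList (entry I)

encodeTable : (I : Input) → List (Chain I) → Data
encodeTable I = encodeList (encodeChain I)

jobs : Input → Data
jobs I@(n , _) = encodeChain I (indices n)

open module DP ((n , js) : Input) = DynamicProgram js
  using (job; below; member; weight; better; best; extend; table; optimum; answer)

precedes⟿ : (j k : Γ → Job) → f ⟿ encodeJob ∘ j → f ⟿ encodeJob ∘ k → f ⟿ (λ γ → fromBool (j γ ≺ᵇ k γ))
precedes⟿ j k J K = ∧⟿ {b = λ γ → Job.b (j γ) ℚ.≤ᵇ Job.ℓ (k γ)} {λ γ → Job.r (j γ) ℚ.≤ᵇ Job.a (k γ)}
  (≤ᵇℚ⟿ {p = Job.b ∘ j} {Job.ℓ ∘ k} (π₁ (π₂ (π₂ (π₂ J)))) (π₁ K))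
  (≤ᵇℚ⟿ {p = Job.r ∘ j} {Job.a ∘ k} (π₁ (π₂ J)) (π₁ (π₂ (π₂ K))))

≡ᶠ⟿ : {n : Γ → ℕ} (i j : (γ : Γ) → Fin (n γ)) →
       f ⟿ (λ γ → atom (ℤ.+ toℕ (i γ))) → f ⟿ (λ γ → atom (ℤ.+ toℕ (j γ))) → f ⟿ (λ γ → fromBool (i γ ≡ᶠ j γ))
≡ᶠ⟿ i j P Q = ∧⟿ {b = λ γ → toℕ (i γ) ≤ᵇ toℕ (j γ)} {λ γ → toℕ (j γ) ≤ᵇ toℕ (i γ)}
  (≤ᵇ⟿ {m = λ γ → ℤ.+ toℕ (i γ)} {λ γ → ℤ.+ toℕ (j γ)} P Q) (≤ᵇ⟿ {m = λ γ → ℤ.+ toℕ (j γ)} {λ γ → ℤ.+ toℕ (i γ)} Q P)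

below⟿ : _⟿_ {Σ Input λ I → Index I × Chain I}
  (λ (I , k , c) → entry I k ∙ encodeChain I c) (λ (I , k , c) → fromBool (below I k c))
below⟿ = fold at λ (I , k , c) → (I , k) , c
  where
  fold = Fold.foldl⟿ {Σ Input Index} {λ (I , _) → Index I} {λ _ → Bool} {λ (I , k) → entry I k}
    {λ (I , _) → entry I} {λ _ → fromBool}
    (λ _ → true) (λ (I , k) b j → b ∧ (job I j ≺ᵇ job I k))
    (const⟿ 1ℤ)
    (∧⟿ {b = λ (_ , b , _) → b} {λ ((I , k) , _ , j) → job I j ≺ᵇ job I k} (π₁ snd⟿)
      (precedes⟿ (λ ((I , _) , _ , j) → job I j) (λ ((I , k) , _ , _) → job I k) (π₂ (π₂ snd⟿)) (π₂ fst⟿)))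
    (con 2) (λ (I , k) c → size-fromBool (below I k c))

member⟿ : _⟿_ {Σ Input λ I → Index I × Chain I}
  (λ (I , i , c) → entry I i ∙ encodeChain I c) (λ (I , i , c) → fromBool (member I c i))
member⟿ = fold at λ (I , i , c) → (I , i) , c
  where
  fold = Fold.foldl⟿ {Σ Input Index} {λ (I , _) → Index I} {λ _ → Bool} {λ (I , i) → entry I i}
    {λ (I , _) → entry I} {λ _ → fromBool}
    (λ _ → false) (λ (_ , i) b j → b ∨ (i ≡ᶠ j))
    (const⟿ 0ℤ)
    (∨⟿ {b = λ (_ , b , _) → b} {λ ((_ , i) , _ , j) → i ≡ᶠ j} (π₁ snd⟿)
      (≡ᶠ⟿ (λ ((_ , i) , _ , _) → i) (λ (_ , _ , j) → j) (π₁ fst⟿) (π₁ (π₂ snd⟿))))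
    (con 2) (λ (I , i) c → size-fromBool (member I c i))

-- An addition multiplies `height` by at most the height of the new weight, whose logarithm is at
-- most the size of the entry holding it. Along the chain these sizes add up to at most the size of
-- the chain.
size-weight : ∀ I c → size (encodeℚᵘ (weight I c)) ≤ 5 + (size (encodeChain I c) + size (encodeChain I c))
size-weight I@(_ , js) c = begin
  size (encodeℚᵘ (weight I c))                                    ≤⟨ size≤log-height (weight I c) ⟩
  3 + (⌈log₂ height (weight I c) ⌉ + ⌈log₂ height (weight I c) ⌉) ≤⟨ +-monoʳ-≤ 3 (+-mono-≤ (go 0ℚᵘ c) (go 0ℚᵘ c)) ⟩
  -- Each `1` is the logarithm of `height 0ℚᵘ`, which is 2.
  3 + (1 + size (encodeChain I c) + (1 + size (encodeChain I c))) ≡⟨ regroup (size (encodeChain I c)) ⟩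
  5 + (size (encodeChain I c) + size (encodeChain I c))           ∎
  where
  open ≤-Reasoning
  regroup : ∀ s → 3 + (1 + s + (1 + s)) ≡ 5 + (s + s)
  regroup = solve-∀

  w : Index I → ℚ
  w i = Job.w (lookup js i)

  size-w : ∀ i → size (encodeℚ (w i)) ≤ size (entry I i)
  size-w i =
    ≤-trans (size-right (encodeℚ b) (encodeℚ (w i))) (
    ≤-trans (size-right (encodeℚ a) (encodeℚ b ∙ encodeℚ (w i))) (
    ≤-trans (size-right (encodeℚ r) (encodeℚ a ∙ encodeℚ b ∙ encodeℚ (w i))) (
    ≤-trans (size-right (encodeℚ ℓ) (encodeℚ r ∙ encodeℚ a ∙ encodeℚ b ∙ encodeℚ (w i)))
            (size-right (atom (ℤ.+ toℕ i)) (encodeJob (lookup js i))))))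
    where open Job (lookup js i) using (ℓ; r; a; b)

  go : ∀ q c → ⌈log₂ height (foldl (λ q i → q ℚᵘ.+ toℚᵘ (w i)) q c) ⌉
               ≤ ⌈log₂ height q ⌉ + size (encodeChain I c)
  go q []      = m≤m+n _ _
  go q (i ∷ c) = begin
    ⌈log₂ height (foldl _ (q ℚᵘ.+ toℚᵘ (w i)) c) ⌉
      ≤⟨ go (q ℚᵘ.+ toℚᵘ (w i)) c ⟩
    ⌈log₂ height (q ℚᵘ.+ toℚᵘ (w i)) ⌉ + rest
      ≤⟨ +-monoˡ-≤ rest (⌈log₂⌉-mono-≤ (height-+ q (toℚᵘ (w i)))) ⟩
    ⌈log₂ (height q * height (toℚᵘ (w i))) ⌉ + rest
      ≤⟨ +-monoˡ-≤ rest (⌈log₂⌉-*-≤ (height q) (height (toℚᵘ (w i)))) ⟩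
    ⌈log₂ height q ⌉ + ⌈log₂ height (toℚᵘ (w i)) ⌉ + rest
      ≤⟨ +-monoˡ-≤ rest (+-monoʳ-≤ ⌈log₂ height q ⌉ w≤) ⟩
    ⌈log₂ height q ⌉ + size (entry I i) + rest
      ≡⟨ +-assoc ⌈log₂ height q ⌉ _ rest ⟩
    ⌈log₂ height q ⌉ + (size (entry I i) + rest)
      ≤⟨ +-monoʳ-≤ ⌈log₂ height q ⌉ (n≤1+n _) ⟩
    ⌈log₂ height q ⌉ + size (encodeChain I (i ∷ c)) ∎
    where
    rest = size (encodeChain I c)
    w≤ : ⌈log₂ height (toℚᵘ (w i)) ⌉ ≤ size (entry I i)
    w≤ = ≤-trans (log-height≤size (toℚᵘ (w i)))
      (≤-trans (≤-reflexive (cong size (sym (encodeℚ-toℚᵘ (w i))))) (size-w i))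

weight⟿ : _⟿_ {Σ Input Chain} (λ (I , c) → encodeChain I c) (λ (I , c) → encodeℚᵘ (weight I c))
-- The leaf 0 is a dummy environment for the fold.
weight⟿ = const⟿ 0ℤ ∥ id⟿ ▹ Fold.foldl⟿ {Input} {Index} {λ _ → ℚᵘ} {λ _ → atom 0ℤ} {entry} {λ _ → encodeℚᵘ}
  (λ _ → 0ℚᵘ) (λ I q i → q ℚᵘ.+ toℚᵘ (Job.w (job I i)))
  (const⟿ 0ℤ ∥ const⟿ 1ℤ)
  (+ᵘ⟿ {p = λ (_ , q , _) → q} {λ (I , _ , i) → toℚᵘ (Job.w (job I i))} (π₁ snd⟿)
    (recast (λ (I , _ , i) → encodeℚ-toℚᵘ (Job.w (job I i))) (π₂ (π₂ (π₂ (π₂ (π₂ (π₂ snd⟿))))))))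
  (con 5 ⊕ (var ⊕ var))
  (λ I c → ≤-trans (size-weight I c) (+-monoʳ-≤ 5
    (+-mono-≤ (size-right (atom 0ℤ) (encodeChain I c)) (size-right (atom 0ℤ) (encodeChain I c)))))

size-best : ∀ I p tab → size (encodeChain I (best I p tab)) ≤ size (encodeTable I tab)
size-best I p tab = DP.best-elim I p (λ c → size (encodeChain I c) ≤ size (encodeTable I tab)) tab
  (1≤size (encodeTable I tab)) (λ _ d∈ _ → size-∈ (encodeChain I) d∈)

-- Generic in the test and its environment, to serve both the selection below a given job and the
-- unrestricted one at the end.
best⟿ : {I : Γ → Input} {env : Γ → Data} (p : ∀ γ → Chain (I γ) → Bool) →
  _⟿_ {Σ Γ (Chain ∘ I)} (λ (γ , c) → env γ ∙ encodeChain (I γ) c) (λ (γ , c) → fromBool (p γ c)) →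
  _⟿_ {Σ Γ (List ∘ Chain ∘ I)} (λ (γ , tab) → env γ ∙ encodeTable (I γ) tab)
                                 (λ (γ , tab) → encodeChain (I γ) (best (I γ) (p γ) tab))
best⟿ {Γ} {I} {env} p p⟿ = Fold.foldl⟿ {Γ} {Chain ∘ I} {Chain ∘ I} {env}
  {λ γ → encodeChain (I γ)} {λ γ → encodeChain (I γ)}
  (λ _ → []) (λ γ → better (I γ) (p γ))
  (const⟿ 0ℤ)
  (recast (λ (γ , c , d) → sym (if-float (encodeChain (I γ)) (p γ d ∧ (weight (I γ) c ℚᵘ.≤ᵇ weight (I γ) d))))
    (if⟿ {b = λ (γ , c , d) → p γ d ∧ (weight (I γ) c ℚᵘ.≤ᵇ weight (I γ) d)}
         (∧⟿ {b = λ (γ , _ , d) → p γ d} {λ (γ , c , d) → weight (I γ) c ℚᵘ.≤ᵇ weight (I γ) d}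
              (fst⟿ ∥ π₂ snd⟿ ▹ (p⟿ at λ (γ , _ , d) → γ , d))
              (≤ᵇᵘ⟿ {p = λ (γ , c , _) → weight (I γ) c} {λ (γ , _ , d) → weight (I γ) d}
                     (π₁ snd⟿ ▹ (weight⟿ at λ (γ , c , _) → I γ , c))
                     (π₂ snd⟿ ▹ (weight⟿ at λ (γ , _ , d) → I γ , d))))
         (π₂ snd⟿) (π₁ snd⟿)))
  var
  (λ γ tab → ≤-trans (size-best (I γ) (p γ) tab) (size-right (env γ) (encodeTable (I γ) tab)))

module _ {A B : Set} (e : A → Data) (e′ : B → Data) (F : A → B) where

  -- Each image may exceed its source by a common allowance `S` only, which keeps the estimate
  -- additive along the list.
  size-consAll : ∀ {S} → (∀ x → size (e′ (F x)) ≤ size (e x) + S) → ∀ ys xs →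
    size (encodeList e′ (consAll F ys xs)) ≤ size (encodeList e′ ys) + (size (encodeList e xs) + length xs * S)
  size-consAll     F≤ ys []       = m≤m+n _ _
  size-consAll {S} F≤ ys (x ∷ xs) = begin
    size (encodeList e′ (consAll F (F x ∷ ys) xs))
      ≤⟨ size-consAll F≤ (F x ∷ ys) xs ⟩
    suc (size (e′ (F x)) + size (encodeList e′ ys)) + (size (encodeList e xs) + length xs * S)
      ≤⟨ +-monoˡ-≤ _ (s≤s (+-monoˡ-≤ _ (F≤ x))) ⟩
    suc (size (e x) + S + size (encodeList e′ ys)) + (size (encodeList e xs) + length xs * S)
      ≡⟨ regroup (size (e x)) S _ (size (encodeList e xs)) _ ⟩
    size (encodeList e′ ys) + (suc (size (e x) + size (encodeList e xs)) + (S + length xs * S)) ∎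
    where
    open ≤-Reasoning
    regroup : ∀ a s y b t → suc (a + s + y) + (b + t) ≡ y + (suc (a + b) + (s + t))
    regroup = solve-∀

extend⟿ : _⟿_ {Σ Input (List ∘ Chain)}
  (λ (I , tab) → jobs I ∙ encodeTable I tab) (λ (I , tab) → encodeTable I (extend I tab))
-- The table becomes the environment, and the job list is what the loop consumes.
extend⟿ = snd⟿ ∥ fst⟿ ▹ (fold at λ (I , tab) → (I , tab) , indices (proj₁ I))
  where
  bigger : (I : Input) → List (Chain I) → Index I → Chain I
  bigger I tab k = k ∷ best I (below I k) tab

  size-bigger : ∀ I tab k → size (encodeChain I (bigger I tab k)) ≤ size (entry I k) + suc (size (encodeTable I tab))
  size-bigger I tab k = ≤-trans (s≤s (+-monoʳ-≤ (size (entry I k)) (size-best I (below I k) tab)))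
    (≤-reflexive (sym (+-suc (size (entry I k)) _)))

  bound-ok : ∀ ((I , tab) : Σ Input (List ∘ Chain)) xs →
    size (encodeTable I (consAll (bigger I tab) ([] ∷ []) xs)) ≤
      eval (con 3 ⊕ (var ⊕ var ⊗ (con 1 ⊕ var))) (size (encodeTable I tab ∙ encodeChain I xs))
  bound-ok (I , tab) xs = ≤-trans
    (size-consAll (entry I) (encodeChain I) (bigger I tab) (size-bigger I tab) ([] ∷ []) xs)
    (+-monoʳ-≤ 3 (+-mono-≤ xs≤ (*-mono-≤
      (≤-trans (<⇒≤ (length<size (entry I) xs)) xs≤)
      (s≤s (size-left (encodeTable I tab) (encodeChain I xs))))))
    where xs≤ = size-right (encodeTable I tab) (encodeChain I xs)

  fold = Fold.foldl⟿ {Σ Input (List ∘ Chain)} {λ (I , _) → Index I} {λ (I , _) → List (Chain I)}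
    {λ (I , tab) → encodeTable I tab} {λ (I , _) → entry I} {λ (I , _) → encodeTable I}
    (λ _ → [] ∷ []) (λ (I , tab) new k → bigger I tab k ∷ new)
    (const⟿ 0ℤ ∥ const⟿ 0ℤ)
    ((π₂ snd⟿ ∥ (π₂ snd⟿ ∥ fst⟿ ▹
       (best⟿ {Σ Input Index} {proj₁} {λ (I , k) → entry I k} (λ (I , k) → below I k)
              (below⟿ at λ ((I , k) , c) → I , k , c)
        at λ ((I , tab) , _ , k) → (I , k) , tab)))
     ∥ π₁ snd⟿)
    (con 3 ⊕ (var ⊕ var ⊗ (con 1 ⊕ var))) bound-ok

length-table : ∀ I xs → length (table I xs) ≤ suc (length (indices (proj₁ I)))
length-table I = DP.table-elim I (λ tab _ → length tab ≤ suc (length (indices (proj₁ I)))) (s≤s z≤n)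
  λ tab _ _ → ≤-reflexive (length-consAll _ ([] ∷ []) (indices (proj₁ I)))

-- The size bound for a single round would compound over the rounds. Instead, with N the input size,
-- each table has at most N chains of at most N entries, and every entry already occurs in `jobs I`;
-- this gives `q`.
table⟿ : _⟿_ {Σ Input Chain} (λ (I , xs) → jobs I ∙ encodeChain I xs) (λ (I , xs) → encodeTable I (table I xs))
table⟿ = Fold.foldl⟿ {Input} {Index} {List ∘ Chain} {jobs} {entry} {encodeTable}
  (λ _ → [] ∷ []) (λ I tab _ → extend I tab)
  (const⟿ 0ℤ ∥ const⟿ 0ℤ)
  (fst⟿ ∥ π₁ snd⟿ ▹ (extend⟿ at λ (I , tab , _) → I , tab))
  q bound-ok
  where
  q : Poly
  q = con 1 ⊕ var ⊗ (con 1 ⊕ (con 1 ⊕ var ⊗ (con 1 ⊕ var)))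

  bound-ok : ∀ I xs → size (encodeTable I (table I xs)) ≤ eval q (size (jobs I ∙ encodeChain I xs))
  bound-ok I xs = ≤-trans
    (size-encodeList (encodeChain I) (All.map (λ {c} c≤ → chain≤ c c≤) (DP.table-length I xs)))
    (s≤s (*-monoˡ-≤ (suc (suc (N * suc N)))
      (≤-trans (length-table I xs) (≤-trans (length<size (entry I) (indices (proj₁ I))) jobs≤))))
    where
    N = size (jobs I ∙ encodeChain I xs)
    jobs≤ = size-left (jobs I) (encodeChain I xs)
    chain≤ : ∀ c → length c ≤ length xs → size (encodeChain I c) ≤ suc (N * suc N)
    chain≤ c c≤xs = ≤-trans
      (size-encodeList (entry I) (All.universal
        (λ i → ≤-trans (size-∈ (entry I) (DP.∈-indices I i)) jobs≤) c))
      (s≤s (*-monoˡ-≤ (suc N) (≤-trans c≤xs (≤-trans (<⇒≤ (length<size (entry I) xs))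
        (size-right (jobs I) (encodeChain I xs))))))

optimum⟿ : jobs ⟿ (λ I → encodeChain I (optimum I))
-- The job list is duplicated: one copy is the environment of the rounds, the other counts them.
optimum⟿ = const⟿ 0ℤ ∥ (id⟿ ∥ id⟿ ▹ (table⟿ at λ I → I , indices (proj₁ I))) ▹
  (best⟿ {Input} {id} {λ _ → atom 0ℤ} (λ _ _ → true) (const⟿ 1ℤ) at λ I → I , table I (indices (proj₁ I)))

encodeVec-tabulate : ∀ {n} {A : Set} (F : A → Bool) (t : Fin n → A) →
  encodeList fromBool (foldr (λ x bs → F x ∷ bs) [] (List.tabulate t)) ≡ encodeVec fromBool (Vec.tabulate (F ∘ t))
encodeVec-tabulate {zero}  F t = refl
encodeVec-tabulate {suc n} F t = cong (fromBool (F (t zero)) ∙_) (encodeVec-tabulate F (t ∘ suc))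

answer⟿ : _⟿_ {Σ Input Chain} (λ (I , c) → jobs I ∙ encodeChain I c)
                                (λ (I , c) → encodeVec fromBool (answer I c))
answer⟿ = recast eq (snd⟿ ∥ fst⟿ ▹ (fold at λ (I , c) → (I , c) , indices (proj₁ I)))
  where
  eq : ∀ ((I , c) : Σ Input Chain) →
    encodeList fromBool (consAll (member I c) [] (indices (proj₁ I))) ≡ encodeVec fromBool (answer I c)
  eq (I@(n , _) , c) = trans
    (cong (encodeList fromBool) (reverse-foldl (λ bs i → member I c i ∷ bs) [] (allFin n)))
    (encodeVec-tabulate (member I c) id)

  fold = Fold.foldl⟿ {Σ Input Chain} {λ (I , _) → Index I} {λ _ → List Bool}
    {λ (I , c) → encodeChain I c} {λ (I , _) → entry I} {λ _ → encodeList fromBool}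
    (λ _ → []) (λ (I , c) bs i → member I c i ∷ bs)
    (const⟿ 0ℤ)
    ((π₂ snd⟿ ∥ fst⟿ ▹ (member⟿ at λ ((I , c) , _ , i) → I , i , c)) ∥ π₁ snd⟿)
    (con 1 ⊕ (var ⊕ var ⊗ con 2))
    (λ (I , c) xs → let xs≤ = size-right (encodeChain I c) (encodeChain I xs) in ≤-trans
      (size-consAll (entry I) fromBool (member I c)
        (λ i → ≤-trans (size-fromBool (member I c i)) (m≤n+m 2 (size (entry I i)))) [] xs)
      (+-monoʳ-≤ 1 (+-mono-≤ xs≤ (*-monoˡ-≤ 2 (≤-trans (<⇒≤ (length<size (entry I) xs)) xs≤)))))

-- Numbering the jobs of the input

encodeNumbered : ℕ × Job → Data
encodeNumbered (k , j) = atom (ℤ.+ k) ∙ encodeJob j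

number : ℕ × List (ℕ × Job) → Job → ℕ × List (ℕ × Job)
number (k , l) j = suc k , (k , j) ∷ l

1+n≤2^n : ∀ n → suc n ≤ 2 ^ n
1+n≤2^n zero    = ≤-refl
1+n≤2^n (suc n) = +-mono-≤ (m^n>0 2 n) (≤-trans (1+n≤2^n n) (m≤m+n _ 0))

-- A bound linear in the value is enough here, since the counter never exceeds the number of jobs.
size-+ℕ : ∀ n → size (atom (ℤ.+ n)) ≤ suc n
size-+ℕ n = s≤s (≤-trans (⌈log₂⌉-mono-≤ (1+n≤2^n n)) (≤-reflexive (⌈log₂2^n⌉≡n n)))

-- `K` bounds the counter throughout. For each job, `2 + K` pays for the leaf with its number and
-- the node joining the two.
size-number : ∀ K k l xs → k + length xs ≤ K →
  let k′ , l′ = foldl number (k , l) xs in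
  k′ ≤ K × size (encodeList encodeNumbered l′) ≤
    size (encodeList encodeNumbered l) + (size (encodeList encodeJob xs) + length xs * (2 + K))
size-number K k l []       k≤ = ≤-trans (m≤m+n k 0) k≤ , m≤m+n _ _
size-number K k l (j ∷ xs) k≤ =
  let k′≤ , l′≤ = size-number K (suc k) ((k , j) ∷ l) xs (≤-trans (≤-reflexive (sym (+-suc k (length xs)))) k≤)
  in  k′≤ , (begin
    _ ≤⟨ l′≤ ⟩
    suc (suc (size (atom (ℤ.+ k)) + size (encodeJob j)) + L) + (size (encodeList encodeJob xs) + length xs * (2 + K))
      ≤⟨ +-monoˡ-≤ _ (s≤s (s≤s (+-monoˡ-≤ L (+-monoˡ-≤ (size (encodeJob j))
           (≤-trans (size-+ℕ k) (s≤s (≤-trans (m≤m+n k _) k≤))))))) ⟩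
    suc (suc (suc K + size (encodeJob j)) + L) + (size (encodeList encodeJob xs) + length xs * (2 + K))
      ≡⟨ regroup K (size (encodeJob j)) L (size (encodeList encodeJob xs)) (length xs * (2 + K)) ⟩
    L + (suc (size (encodeJob j) + size (encodeList encodeJob xs)) + (2 + K + length xs * (2 + K))) ∎)
  where
  open ≤-Reasoning
  L = size (encodeList encodeNumbered l)
  regroup : ∀ k a l b t → suc (suc (suc k + a) + l) + (b + t) ≡ l + (suc (a + b) + (2 + k + t))
  regroup = solve-∀

-- `e` is tied to the data by an equation only, because the recursive call shifts the offset and the
-- positions in the vector together.
numbered-tabulate : ∀ {m} (js : Vec Job m) k l (e : Fin m → Data) →
  (∀ i → e i ≡ encodeNumbered (k + toℕ i , lookup js i)) →
  encodeList encodeNumbered (proj₂ (foldl number (k , l) (toList js)))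
    ≡ foldl (flip _∙_) (encodeList encodeNumbered l) (List.tabulate e)
numbered-tabulate []       k l e eq = refl
numbered-tabulate (j ∷ js) k l e eq = trans
  (numbered-tabulate js (suc k) ((k , j) ∷ l) (e ∘ suc)
    (λ i → trans (eq (suc i)) (cong (λ x → encodeNumbered (x , lookup js i)) (+-suc k (toℕ i)))))
  (cong (λ d → foldl (flip _∙_) (d ∙ encodeList encodeNumbered l) (List.tabulate (e ∘ suc)))
    (sym (trans (eq zero) (cong (λ x → encodeNumbered (x , j)) (+-identityʳ k)))))

encodeList-foldr : ∀ {A : Set} (e : A → Data) xs → encodeList e xs ≡ foldr (λ x d → e x ∙ d) (atom 0ℤ) xs
encodeList-foldr e []       = refl
encodeList-foldr e (x ∷ xs) = cong (e x ∙_) (encodeList-foldr e xs)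

encodeVec-toList : ∀ {A : Set} {n} (e : A → Data) (xs : Vec A n) → encodeVec e xs ≡ encodeList e (toList xs)
encodeVec-toList e []       = refl
encodeVec-toList e (x ∷ xs) = cong (e x ∙_) (encodeVec-toList e xs)

numbered≡jobs : ∀ ((n , js) : Input) →
  encodeList encodeNumbered (proj₂ (foldl number (0 , []) (toList js))) ≡ jobs (n , js)
numbered≡jobs I@(n , js) = begin
  encodeList encodeNumbered (proj₂ (foldl number (0 , []) (toList js)))
    ≡⟨ numbered-tabulate js 0 [] (entry I) (λ _ → refl) ⟩
  foldl (flip _∙_) (atom 0ℤ) (List.tabulate (entry I))
    ≡⟨ cong (foldl (flip _∙_) (atom 0ℤ)) (map-tabulate id (entry I)) ⟨
  foldl (flip _∙_) (atom 0ℤ) (map (entry I) (allFin n))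
    ≡⟨ foldl-map (flip _∙_) (entry I) (atom 0ℤ) (allFin n) ⟩
  foldl (λ d i → entry I i ∙ d) (atom 0ℤ) (allFin n)
    ≡⟨ reverse-foldr (λ i d → entry I i ∙ d) (atom 0ℤ) (allFin n) ⟨
  foldr (λ i d → entry I i ∙ d) (atom 0ℤ) (indices n)
    ≡⟨ encodeList-foldr (entry I) (indices n) ⟨
  jobs I ∎
  where open ≡-Reasoning

jobs⟿ : (λ (_ , js) → encodeVec encodeJob js) ⟿ jobs
jobs⟿ = recast numbered≡jobs (π₂
  (const⟿ 0ℤ ∥ recast (λ (_ , js) → encodeVec-toList encodeJob js) id⟿ ▹ (fold at λ (_ , js) → tt , toList js)))
  where
  q : Poly
  q = con 1 ⊕ ((con 1 ⊕ var) ⊕ (con 1 ⊕ (var ⊕ var ⊗ (con 2 ⊕ var))))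

  encodeState : ℕ × List (ℕ × Job) → Data
  encodeState (k , l) = atom (ℤ.+ k) ∙ encodeList encodeNumbered l

  bound-ok : ∀ (_ : ⊤) xs → size (encodeState (foldl number (0 , []) xs)) ≤ eval q (size (atom 0ℤ ∙ encodeList encodeJob xs))
  bound-ok _ xs =
    let N       = size (atom 0ℤ ∙ encodeList encodeJob xs)
        xs≤     = size-right (atom 0ℤ) (encodeList encodeJob xs)
        k≤ , l≤ = size-number N 0 [] xs (≤-trans (<⇒≤ (length<size encodeJob xs)) xs≤)
    in  s≤s (+-mono-≤ (≤-trans (size-+ℕ _) (s≤s k≤))
          (≤-trans l≤ (s≤s (+-mono-≤ xs≤ (*-monoˡ-≤ (2 + N) (≤-trans (<⇒≤ (length<size encodeJob xs)) xs≤))))))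

  fold = Fold.foldl⟿ {⊤} {λ _ → Job} {λ _ → ℕ × List (ℕ × Job)} {λ _ → atom 0ℤ} {λ _ → encodeJob} {λ _ → encodeState}
    (λ _ → 0 , []) (λ _ → number)
    (const⟿ 0ℤ ∥ const⟿ 0ℤ)
    -- The 1 is added on the left so that the sum computes to `suc k`.
    (let k = π₁ (π₁ snd⟿) in +⟿ (const⟿ 1ℤ) k ∥ (k ∥ π₂ snd⟿) ∥ π₂ (π₁ snd⟿))
    q bound-ok

-- Assembling the algorithm

solution⟿ : (λ (_ , js) → encodeVec encodeJob js) ⟿ (λ I → encodeVec fromBool (answer I (optimum I)))
solution⟿ = jobs⟿ ▹ id⟿ ∥ optimum⟿ ▹ (answer⟿ at λ I → I , optimum I)

polynomialTimeSolvable : (Π : SearchProblem) → let open SearchProblem Π in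
  (A : ∀ I → Answer I) → encodeInstance ⟿ (λ I → encodeAnswer (A I)) → (∀ I → Correct I (A I)) →
  PolynomialTimeSolvable Π
polynomialTimeSolvable Π A P correct =
  program P , coeff (bound P) * 2 ^ degree (bound P) , degree (bound P) , λ I →
    let t , run , t≤ = runs P I in
    A I , t , run , ≤-trans t≤ (eval≤monomial (bound P) _ (1≤size (encodeInstance I))) , correct I
  where open SearchProblem Π

theorem8 : PolynomialTimeSolvable IntervalSchedulingWithColors
theorem8 = polynomialTimeSolvable IntervalSchedulingWithColors
  (λ I → answer I (optimum I)) solution⟿ (λ I → DP.optimum-maximum I)
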